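{- Let $T$ be a tree. Then $\mathrm{pthin}(T)=2$ if and only if the following three conditions hold simultaneously: (1) $T$ has a vertex of degree at least $3$; (2) every vertex of $T$ of degree at least $5$ has at most $4$ neighbors of degree greater than $1$; (3) there exists a simple path $C_0$ in $T$ such that (a) every vertex of $T$ of degree at least $4$ lies on $C_0$, and (b) for every vertex $v$ of degree exactly $3$ that does not lie on $C_0$, $v$ is adjacent to some vertex $w$ of $C_0$, and this $w$ has degree at most $3$. (All degrees are degrees in $T$.)
   Context: All graphs are finite, simple, undirected. For a graph $G=(V,E)$, a linear ordering $<$ of $V$ and a partition of $V$ into classes are called strongly consistent if for every triple $r<s<t$ of vertices with $rt\in E$: if $r$ and $s$ belong to the same class then $st\in E$, and if $s$ and $t$ belong to the same class then $rs\in E$. $G$ is proper $k$-thin if there is an ordering of $V$ and a partition of $V$ into $k$ classes that are strongly consistent. The proper thinness $\mathrm{pthin}(G)$ is the minimum $k$ such that $G$ is proper $k$-thin. (Graphs with proper thinness $1$ are exactly the proper interval graphs; among trees, exactly the paths.) -}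

module Defs where

open import Data.Fin.Base using (Fin)
open import Data.List.Base using (List; []; _∷_; length; filter; allFin; last)
open import Data.List.Membership.Propositional using (_∈_; _∉_)
open import Data.List.Relation.Unary.Linked using (Linked)
open import Data.List.Relation.Unary.Unique.Propositional using (Unique)
open import Data.Maybe.Base using (just)
open import Data.Nat.Base using (ℕ; _≤_; _<_)
open import Data.Nat.Properties using (_<?_)
open import Data.Product.Base using (Σ; ∃; ∃-syntax; _×_)
open import Function.Definitions using (StrictlySurjective)
open import Level using (0ℓ)
open import Relation.Binary.Core using (Rel)
open import Relation.Binary.Definitions using (Decidable; Symmetric; Irreflexive)
open import Relation.Binary.Structures using (IsStrictTotalOrder)
open import Relation.Binary.Construct.Closure.ReflexiveTransitive using (Star)
open import Relation.Binary.PropositionalEquality using (_≡_; _≢_)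
open import Relation.Nullary using (¬_)
open import Relation.Nullary.Decidable using (_×-dec_)

record Graph (n : ℕ) : Set₁ where
  field
    Adj    : Rel (Fin n) 0ℓ
    adj?   : Decidable Adj
    sym    : Symmetric Adj
    irrefl : Irreflexive _≡_ Adj

module _ {n : ℕ} (G : Graph n) where
  open Graph G

  degree : Fin n → ℕ
  degree v = length (filter (adj? v) (allFin n))

  nonLeafNeighbors : Fin n → List (Fin n)
  nonLeafNeighbors v = filter (λ w → adj? v w ×-dec 1 <? degree w) (allFin n)

  IsSimplePath : List (Fin n) → Set
  IsSimplePath vs = vs ≢ [] × Linked Adj vs × Unique vs

  -- The vertices of a cycle are listed once each; the closing edge joins the
  -- last one to the first.
  IsCycle : List (Fin n) → Set
  IsCycle vs = IsSimplePath vs × 3 ≤ length vs ×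
               ∃[ u ] ∃[ us ] ∃[ w ] (vs ≡ u ∷ us × last vs ≡ just w × Adj w u)

  Connected : Set
  Connected = ∀ u v → Star Adj u v

  Acyclic : Set
  Acyclic = ∀ vs → ¬ IsCycle vs

  record IsTree : Set where
    field
      nonempty  : 1 ≤ n
      connected : Connected
      acyclic   : Acyclic

  -- A partition into k classes is given by the map sending each vertex to the
  -- index of its class.
  StronglyConsistent : {k : ℕ} → Rel (Fin n) 0ℓ → (Fin n → Fin k) → Set
  StronglyConsistent _≺_ class =
    ∀ {r s t} → r ≺ s → s ≺ t → Adj r t →
    (class r ≡ class s → Adj s t) × (class s ≡ class t → Adj r s)

  -- Surjectivity of the class map says that no class is empty.
  ProperThin : ℕ → Set₁
  ProperThin k =
    Σ (Rel (Fin n) 0ℓ) λ _≺_ → ∃ λ (class : Fin n → Fin k) →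
    IsStrictTotalOrder _≡_ _≺_ × StrictlySurjective _≡_ class ×
    StronglyConsistent _≺_ class

  -- pthin(G) = k
  HasProperThinness : ℕ → Set₁
  HasProperThinness k = ProperThin k × (∀ j → ProperThin j → k ≤ j)

  HasVertexOfDegree≥3 : Set
  HasVertexOfDegree≥3 = ∃[ v ] 3 ≤ degree v

  FewNonLeafNeighbors : Set
  FewNonLeafNeighbors = ∀ v → 5 ≤ degree v → length (nonLeafNeighbors v) ≤ 4

  HasSpine : Set
  HasSpine = ∃[ C₀ ]
    ( IsSimplePath C₀
    × (∀ v → 4 ≤ degree v → v ∈ C₀)
    × (∀ v → degree v ≡ 3 → v ∉ C₀ → ∃[ w ] (w ∈ C₀ × Adj v w × degree w ≤ 3)))

{-# OPTIONS --safe #-}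

-- Because a tree has no triangles, strong consistency forces an edge inside a class
-- to join consecutive vertices of that class, and the neighbours of v in the other
-- class to form an interval around v.  Hence the neighbours of v in the other class,
-- apart from the two extreme ones, are leaves, which gives (2).  For (3), C₀ is the
-- path from the least to the greatest vertex: every vertex v off C₀ is crossed by an
-- edge of C₀, and acyclicity then leaves only one way for v to have degree 3: v is
-- attached to an end w of a crossing edge lying in the other class, and has a
-- neighbour on either side in its own class, which keeps the degree of w down to 3.
--
-- Conversely, a spine that cannot be lengthened carries at most two non-trivial
-- branches at each of its vertices, or a single branch which splits once next to the
-- spine.  The spine forms one class and the branches the other; around each spine
-- vertex one branch is laid out to the left and one to the right, with the leaves
-- next to it on the left.
module Submission where

open import Defs
open import Data.Empty using (⊥; ⊥-elim)
open import Data.Fin.Base as Fin using (Fin; zero; suc; toℕ)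
open import Data.Fin.Properties as Fin using (_≟_; any?; injective⇒≤; toℕ-injective)
open import Data.Integer.Base as ℤ using (ℤ; +_; -[1+_]; -≤-; +≤+)
import Data.Integer.Properties as ℤ
open import Data.List.Base using (List; []; _∷_; _++_; _ʳ++_; length; filter; allFin; last; lookup; reverse)
open import Data.List.Membership.Propositional using (_∈_; _∉_)
open import Data.List.Membership.Propositional.Properties
  using (∈-lookup; ∈-filter⁺; ∈-filter⁻; ∈-allFin; ∈-AllPairs₂)
open import Data.List.Properties using (length-tabulate; length-reverse; ++-ʳ++; ʳ++-ʳ++; ++-identityʳ)
open import Data.List.Relation.Unary.All as All using (All; []; _∷_)
open import Data.List.Relation.Unary.All.Properties using (¬Any⇒All¬; All¬⇒¬Any)
open import Data.List.Relation.Unary.AllPairs.Core using ([]; _∷_)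
open import Data.List.Relation.Unary.Any using (Any; here; there; index)
open import Data.List.Relation.Unary.Any.Properties using (lookup-index; reverse⁻; reverse⁺; reverseAcc⁺)
open import Data.List.Relation.Unary.Linked as Linked using (Linked; [-]; _∷_)
open import Data.List.Relation.Unary.Linked.Properties using (Linked⇒AllPairs)
open import Data.List.Relation.Unary.Unique.Propositional using (Unique)
import Data.List.Relation.Unary.Unique.Propositional.Properties as Unique
open import Data.Maybe.Base using (just)
open import Data.Nat.Base using (ℕ; zero; suc; pred; _+_; _≤_; _<_; z≤n; s≤s)
import Data.Nat.Properties as ℕ
open import Data.Product.Base using (∃; ∃-syntax; _×_; _,_; proj₁; proj₂)
open import Data.Product.Relation.Binary.Lex.Strict using (×-Lex; ×-isStrictTotalOrder)
open import Data.Sum.Base using (_⊎_; inj₁; inj₂; [_,_]′)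
open import Function.Base using (_∘_; case_of_; flip; _on_)
open import Function.Bundles using (_⇔_; mk⇔)
open import Level using (0ℓ)
open import Relation.Binary.Construct.Closure.ReflexiveTransitive using (Star; ε; _◅_)
import Relation.Binary.Construct.Flip.EqAndOrd as Flip
open import Relation.Binary.Core using (Rel)
open import Relation.Binary.Definitions using (tri<; tri≈; tri>)
open import Relation.Binary.PropositionalEquality
  using (_≡_; _≢_; refl; sym; trans; cong; subst; subst₂; isEquivalence; ≢-sym)
open import Relation.Binary.Structures using (IsStrictTotalOrder)
open import Relation.Nullary using (¬_; Dec; yes; no; contradiction)
open import Relation.Nullary.Decidable using (¬?; _×-dec_; _→-dec_; decidable-stable)

-- Counting in duplicate-free lists.

module _ {A : Set} where

  lookup-injective : ∀ {xs : List A} → Unique xs → ∀ {i j} → lookup xs i ≡ lookup xs j → i ≡ j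
  lookup-injective (_ ∷ _) {zero} {zero} _ = refl
  lookup-injective (x∉ ∷ _) {zero} {suc j} eq = contradiction eq (All.lookup x∉ (∈-lookup j))
  lookup-injective (x∉ ∷ _) {suc i} {zero} eq = contradiction (sym eq) (All.lookup x∉ (∈-lookup i))
  lookup-injective (_ ∷ u) {suc i} {suc j} eq = cong suc (lookup-injective u eq)

  AtMostOne : (A → Set) → Set
  AtMostOne Q = ∀ {x y} → Q x → Q y → x ≡ y

  length≤-injection : ∀ {k} {xs : List A} → Unique xs → (f : ∀ {x} → x ∈ xs → Fin k) →
            (∀ {x y} (p : x ∈ xs) (q : y ∈ xs) → f p ≡ f q → x ≡ y) → length xs ≤ k
  length≤-injection u f f-inj = injective⇒≤ {f = λ i → f (∈-lookup i)}
    (λ {i} {j} eq → lookup-injective u (f-inj (∈-lookup i) (∈-lookup j) eq))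

  -- Pigeonhole on the index of the covering property. Degrees are bounded from above in this way: a
  -- few properties, each holding for at most one vertex, exhaust the neighbours.
  length≤ : ∀ {xs : List A} {Qs : List (A → Set)} → Unique xs → All AtMostOne Qs →
            (∀ {x} → x ∈ xs → Any (λ Q → Q x) Qs) → length xs ≤ length Qs
  length≤ {Qs = Qs} u one cover = length≤-injection u (λ p → index (cover p))
    (λ {x} {y} p q eq → All.lookup one (∈-lookup (index (cover q)))
      (subst (λ i → lookup Qs i x) eq (lookup-index (cover p))) (lookup-index (cover q)))

  length-⊆ : ∀ {xs ys : List A} → Unique xs → (∀ {x} → x ∈ xs → x ∈ ys) → length xs ≤ length ys
  length-⊆ {ys = ys} u sub = length≤-injection u (λ p → index (sub p))
    (λ p q eq → trans (lookup-index (sub p)) (trans (cong (lookup ys) eq) (sym (lookup-index (sub q)))))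

-- Simple paths in a graph.

module Paths {n : ℕ} (G : Graph n) where
  open Graph G renaming (sym to adj-sym)

  private
    V = Fin n
    variable
      x y z c d u v w : V
      p q C : List V

  open import Data.List.Membership.DecPropositional (_≟_ {n}) public using (_∈?_)

  adj⇒≢ : Adj x y → x ≢ y
  adj⇒≢ a eq = irrefl eq a

  degree≤ : ∀ {Qs : List (V → Set)} → All AtMostOne Qs →
            (∀ {u} → Adj v u → Any (λ Q → Q u) Qs) → degree G v ≤ length Qs
  degree≤ {v} one cover = length≤ (Unique.filter⁺ (adj? v) (Unique.allFin⁺ n)) one
    (λ p → cover (proj₂ (∈-filter⁻ (adj? v) {xs = allFin n} p)))

  ≤degree : ∀ {us} → Unique us → All (Adj v) us → length us ≤ degree G v
  ≤degree {v} u as = length-⊆ u (λ p → ∈-filter⁺ (adj? v) (∈-allFin _) (All.lookup as p))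

  ≤nonLeafNeighbors : ∀ {us} → Unique us → All (λ u → Adj v u × 2 ≤ degree G u) us →
                      length us ≤ length (nonLeafNeighbors G v)
  ≤nonLeafNeighbors {v} u as = length-⊆ u
    (λ p → ∈-filter⁺ (λ w → adj? v w ×-dec 1 ℕ.<? degree G w) (∈-allFin _) (All.lookup as p))

  nonLeafNeighbors≤ : ∀ {Qs : List (V → Set)} → All AtMostOne Qs →
    (∀ {u} → Adj v u → 2 ≤ degree G u → Any (λ Q → Q u) Qs) → length (nonLeafNeighbors G v) ≤ length Qs
  nonLeafNeighbors≤ {v} one cover = length≤ (Unique.filter⁺ nl? (Unique.allFin⁺ n)) one
    (λ p → let (a , u₂) = proj₂ (∈-filter⁻ nl? {xs = allFin n} p) in cover a u₂)
    where
    nl? = λ w → adj? v w ×-dec 1 ℕ.<? degree G w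

  otherNeighbor : 2 ≤ degree G v → ∀ w → ∃[ u ] (Adj v u × u ≢ w)
  otherNeighbor {v} v₂ w with any? (λ u → adj? v u ×-dec ¬? (u ≟ w))
  ... | yes found = found
  ... | no none = contradiction v₂ (ℕ.<⇒≱ (s≤s (degree≤ ((λ { refl refl → refl }) ∷ []) (here ∘ all-w))))
    where
    all-w : Adj v u → u ≡ w
    all-w {u} a with u ≟ w
    ... | yes eq = eq
    ... | no u≢w = contradiction (_ , a , u≢w) none

  -- Both ends are indices and freshness is stored at each step, so that recursion on the path
  -- replaces separate reasoning about `Linked`, `Unique` and `last`.
  data Path : V → V → List V → Set where
    stop : Path x x (x ∷ [])
    step : Adj x y → x ∉ p → Path y z p → Path x z (x ∷ p)

  start∈ : Path x z p → x ∈ p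
  start∈ stop = here refl
  start∈ (step _ _ _) = here refl

  end∈ : Path x z p → z ∈ p
  end∈ stop = here refl
  end∈ (step _ _ P) = there (end∈ P)

  head-unique : Path x z (y ∷ p) → x ≡ y
  head-unique stop = refl
  head-unique (step _ _ _) = refl

  private
    unique-cons : x ∉ p → Unique p → Unique (x ∷ p)
    unique-cons x∉p u = ¬Any⇒All¬ _ x∉p ∷ u

    linked-cons : Adj x y → Path y z p → Linked Adj p → Linked Adj (x ∷ p)
    linked-cons a stop l = a ∷ l
    linked-cons a (step _ _ _) l = a ∷ l

  path-unique : Path x z p → Unique p
  path-unique stop = [] ∷ []
  path-unique (step _ x∉p P) = unique-cons x∉p (path-unique P)

  path-linked : Path x z p → Linked Adj p
  path-linked stop = [-]
  path-linked (step a _ P) = linked-cons a P (path-linked P)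

  path-simple : Path x z p → IsSimplePath G p
  path-simple P = nonempty P , path-linked P , path-unique P
    where
    nonempty : Path x z p → p ≢ []
    nonempty stop ()
    nonempty (step _ _ _) ()

  simple-path : IsSimplePath G p → ∃[ x ] ∃[ z ] Path x z p
  simple-path {[]} (ne , _) = contradiction refl ne
  simple-path {x ∷ []} _ = x , x , stop
  simple-path {x ∷ y ∷ p} (_ , a ∷ l , x∉ ∷ u) with simple-path {y ∷ p} ((λ ()) , l , u)
  ... | x′ , z , P with refl ← head-unique P = x , z , step a (All¬⇒¬Any x∉) P

  path-last : Path x z p → last p ≡ just z
  path-last stop = refl
  path-last (step _ _ P) = last-cons P (path-last P)
    where
    last-cons : Path x z p → last p ≡ just z → last (w ∷ p) ≡ just z
    last-cons stop eq = eq
    last-cons (step _ _ _) eq = eq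

  path-prefix : Path x z p → y ∈ p → ∃[ q ] (Path x y q × (∀ {v} → v ∈ q → v ∈ p))
  path-prefix stop (here refl) = _ , stop , λ i → i
  path-prefix (step _ _ _) (here refl) = _ , stop , λ { (here refl) → here refl }
  path-prefix (step a x∉p P) (there i) with path-prefix P i
  ... | q , Q , sub = _ , step a (x∉p ∘ sub) Q , λ { (here eq) → here eq ; (there j) → there (sub j) }

  path-suffix : Path x z p → y ∈ p → ∃[ q ] (Path y z q × (∀ {v} → v ∈ q → v ∈ p))
  path-suffix stop (here refl) = _ , stop , λ i → i
  path-suffix (step a x∉p P) (here refl) = _ , step a x∉p P , λ i → i
  path-suffix (step _ _ P) (there i) with path-suffix P i
  ... | q , Q , sub = q , Q , λ j → there (sub j)

  -- If `x` is already on the path, the detour is cut off by passing to the suffix from `x`. This is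
  -- what turns walks into simple paths.
  path-cons : Adj x y → Path y z p → ∃[ q ] (Path x z q × (∀ {v} → v ∈ q → v ≡ x ⊎ v ∈ p))
  path-cons {x} {p = p} a P with x ∈? p
  ... | no x∉p = _ , step a x∉p P , λ { (here eq) → inj₁ eq ; (there i) → inj₂ i }
  ... | yes x∈p with path-suffix P x∈p
  ... | q , Q , sub = q , Q , λ i → inj₂ (sub i)

  path-++ : Path x y p → Path y z q → ∃[ r ] (Path x z r × (∀ {v} → v ∈ r → v ∈ p ⊎ v ∈ q))
  path-++ stop Q = _ , Q , inj₂
  path-++ (step a _ P) Q with path-++ P Q
  ... | r , R , sub with path-cons a R
  ... | s , S , sub′ = s , S , λ i → case sub′ i of λ where
    (inj₁ refl) → inj₁ (here refl)
    (inj₂ j) → case sub j of λ where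
      (inj₁ k) → inj₁ (there k)
      (inj₂ k) → inj₂ k

  path-ʳ++ : Path x z p → Adj x y → Path y w q → (∀ {v} → v ∈ p → v ∉ q) → Path z w (p ʳ++ q)
  path-ʳ++ stop a Q disj = step a (disj (here refl)) Q
  path-ʳ++ (step b x∉p P) a Q disj =
    path-ʳ++ P (adj-sym b) (step a (disj (here refl)) Q)
      λ { i (here refl) → x∉p i ; i (there j) → disj (there i) j }

  path-reverse : Path x z p → Path z x (reverse p)
  path-reverse stop = stop
  path-reverse (step a x∉p P) = path-ʳ++ P (adj-sym a) stop λ { i (here refl) → x∉p i }

  path-ʳ++⁻ : ∀ bs → Path x z (bs ʳ++ (y ∷ p)) → Path y z (y ∷ p)
  path-ʳ++⁻ [] P with refl ← head-unique P = P
  path-ʳ++⁻ (b ∷ bs) P with path-ʳ++⁻ bs P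
  ... | step _ _ Q with refl ← head-unique Q = Q

  path-second : Path x z (x ∷ y ∷ p) → Adj x y
  path-second (step a _ P) with refl ← head-unique P = a

  path-tail : Path x z (x ∷ y ∷ p) → Path y z (y ∷ p)
  path-tail (step _ _ P) with refl ← head-unique P = P

-- Consequences of acyclicity.

module Trees {n : ℕ} (T : Graph n) (isTree : IsTree T) where
  open Graph T renaming (sym to adj-sym)
  open IsTree isTree
  open Paths T public

  private
    V = Fin n
    variable
      x y z c d u v w : V
      p q C : List V

  -- If the ends differed, the path would have at least two vertices and `v` would close it to a
  -- cycle. Acyclicity enters only in this form.
  no-cycle : Path u w p → v ∉ p → Adj v u → Adj v w → u ≡ w
  no-cycle stop _ _ _ = refl
  no-cycle {v = v} P@(step {y = y} _ x∉p Q) v∉p a b = contradiction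
    (path-simple (step a v∉p P) , long Q ,
     v , _ , _ , refl , path-last (step a v∉p P) , adj-sym b)
    (acyclic _)
    where
    long : Path x z q → 3 ≤ suc (suc (length q))
    long stop = s≤s (s≤s (s≤s z≤n))
    long (step _ _ _) = s≤s (s≤s (s≤s z≤n))

  no-triangle : Adj x y → Adj y z → Adj x z → ⊥
  no-triangle {x} {y} {z} a b c = adj⇒≢ b (no-cycle {v = x}
    (step b (λ { (here eq) → adj⇒≢ b eq }) stop)
    (λ { (here eq) → adj⇒≢ a eq ; (there (here eq)) → adj⇒≢ c eq }) a c)

  no-4-cycle : Adj x y → Adj y z → Adj z w → Adj w x → x ≢ z → y ≡ w
  no-4-cycle {x} {y} {z} {w} a b c d x≢z with y ≟ w
  ... | yes eq = eq
  ... | no y≢w = no-cycle {v = x}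
    (step b (λ { (here eq) → adj⇒≢ b eq ; (there (here eq)) → y≢w eq })
      (step c (λ { (here eq) → adj⇒≢ c eq }) stop))
    (λ { (here eq) → adj⇒≢ a eq ; (there (here eq)) → x≢z eq ; (there (there (here eq))) → adj⇒≢ d (sym eq) })
    a (adj-sym d)

  -- Otherwise the piece of the path from `d` to `u` joins two different neighbours of `c` while
  -- avoiding `c`.
  path-extend : Path c z (c ∷ d ∷ p) → Adj u c → u ≢ d → u ∉ c ∷ d ∷ p
  path-extend P a u≢d (here eq) = adj⇒≢ a eq
  path-extend P@(step _ c∉p Q) a u≢d (there i) with path-prefix (path-tail P) i
  ... | q , R , sub = contradiction (sym (no-cycle R (c∉p ∘ sub) (path-second P) (adj-sym a))) u≢d

  path-unique-list : Path x z p → Path x z q → p ≡ q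
  path-unique-list stop stop = refl
  path-unique-list stop (step _ x∉q Q) = contradiction (end∈ Q) x∉q
  path-unique-list (step _ x∉p P) stop = contradiction (end∈ P) x∉p
  path-unique-list {x} (step a x∉p P) (step b x∉q Q) with path-++ P (path-reverse Q)
  -- One tail followed by the reverse of the other joins the second vertices of the two paths and
  -- avoids `x`, so these vertices agree.
  ... | r , R , sub with no-cycle R (λ i → [ x∉p , (λ j → x∉q (reverse⁻ j)) ]′ (sub i)) a b
  ... | refl = cong (x ∷_) (path-unique-list P Q)

  path-between : ∀ x z → ∃[ p ] Path x z p
  path-between x z = go (connected x z)
    where
    go : ∀ {x} → Star Adj x z → ∃[ p ] Path x z p
    go ε = _ , stop
    go (a ◅ as) with go as
    ... | _ , P with path-cons a P
    ... | q , Q , _ = q , Q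

-- Parents and depths in a rooted tree.

module Rooted {n : ℕ} (T : Graph n) (isTree : IsTree T) (ρ : Fin n) where
  open Graph T renaming (sym to adj-sym)
  open Trees T isTree

  private
    V = Fin n
    variable
      x y z : V
      p q : List V

  private
    second : V → List V → V
    second x (_ ∷ y ∷ _) = y
    second x _ = x

    route : V → List V
    route x = proj₁ (path-between x ρ)

    route-path : ∀ x → Path x ρ (route x)
    route-path x = proj₂ (path-between x ρ)

  -- At the root, junk: parent ρ ≡ ρ.
  parent : V → V
  parent x = second x (route x)

  depth : V → ℕ
  depth x = pred (length (route x))

  -- The depth condition keeps the root, which is its own parent by the junk value, from being a
  -- child.
  Child : V → V → Set
  Child x y = parent x ≡ y × depth x ≡ suc (depth y)

  depth-root : depth ρ ≡ 0
  depth-root = cong (pred ∘ length) (path-unique-list (route-path ρ) stop)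

  private
    child-of : Path y ρ p → x ∉ p → Adj x y → route x ≡ x ∷ p → Child x y
    child-of {y} {p} {x} P x∉p a eq with p | P | path-unique-list (route-path y) P
    ... | _ | stop | eq′ = cong (second x) eq , trans (cong (pred ∘ length) eq) (cong suc (sym (cong (pred ∘ length) eq′)))
    ... | _ | step _ _ _ | eq′ = cong (second x) eq , trans (cong (pred ∘ length) eq) (cong suc (sym (cong (pred ∘ length) eq′)))

  -- Either `y` is off the route from `x` to the root, and prepending it gives the route of `y`, or
  -- it is on that route, where acyclicity makes it the second vertex.
  adj⇒child : Adj x y → Child x y ⊎ Child y x
  adj⇒child {x} {y} a with y ∈? route x
  ... | no y∉ = inj₂ (child-of (route-path x) y∉ (adj-sym a)
                       (path-unique-list (route-path y) (step (adj-sym a) y∉ (route-path x))))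
  ... | yes y∈ = inj₁ (along (route-path x) refl y∈)
    where
    along : Path x ρ p → route x ≡ p → y ∈ p → Child x y
    along P _ (here y≡x) = contradiction (trans (head-unique P) (sym y≡x)) (adj⇒≢ a)
    along (step {y = c} b x∉p P) eq (there y∈p) with path-prefix P y∈p
    ... | q , Q , sub with refl ← no-cycle Q (x∉p ∘ sub) b a = child-of P x∉p a eq

  parent-adj : x ≢ ρ → Adj x (parent x) × depth x ≡ suc (depth (parent x))
  parent-adj {x} x≢ρ = along (route-path x) refl
    where
    along : Path x ρ p → route x ≡ p → Adj x (parent x) × depth x ≡ suc (depth (parent x))
    along stop _ = contradiction refl x≢ρ
    along (step {y = y} a x∉p P) eq with parent≡ , depth≡ ← child-of P x∉p a eq =
      subst (λ y → Adj x y × depth x ≡ suc (depth y)) (sym parent≡) (a , depth≡)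

  depth≡0⇒root : depth x ≡ 0 → x ≡ ρ
  depth≡0⇒root {x} d with x ≟ ρ
  ... | yes eq = eq
  ... | no x≢ρ with () ← trans (sym d) (proj₂ (parent-adj x≢ρ))

  child≢root : Child x y → x ≢ ρ
  child≢root (_ , d) refl with () ← trans (sym depth-root) d

-- Branches hanging off a spine that starts at the root.

module Spine {n : ℕ} (T : Graph n) (isTree : IsTree T) {ρ ζ : Fin n} {C : List (Fin n)}
             (spine : Paths.Path T ρ ζ C) where
  open Graph T renaming (sym to adj-sym)
  open Trees T isTree
  open Rooted T isTree ρ public

  private
    V = Fin n
    variable
      c x y z : V
      p q : List V

  root∈ : ρ ∈ C
  root∈ = start∈ spine

  ∉⇒≢root : x ∉ C → x ≢ ρ
  ∉⇒≢root x∉C refl = x∉C root∈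

  spine-linked : Linked (λ c d → Child d c) C
  spine-linked = go spine λ ≢ρ → contradiction refl ≢ρ
    where
    -- The invariant forbids a step towards the root, since such a step would put the parent of `c`
    -- on the path.
    go : Path c z p → (c ≢ ρ → parent c ∉ p) → Linked (λ c d → Child d c) p
    go stop _ = [-]
    go (step a c∉p P) h with adj⇒child a
    ... | inj₁ ch = contradiction (there (subst (_∈ _) (sym (proj₁ ch)) (start∈ P))) (h (child≢root ch))
    ... | inj₂ ch = cons P ch (go P λ _ i → c∉p (subst (_∈ _) (proj₁ ch) i))
      where
      cons : Path y z p → Child y c → Linked (λ c d → Child d c) p → Linked (λ c d → Child d c) (c ∷ p)
      cons stop ch l = ch ∷ l
      cons (step _ _ _) ch l = ch ∷ l

  parent∈ : x ∈ C → x ≢ ρ → parent x ∈ C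
  parent∈ i x≢ρ = go spine spine-linked i x≢ρ
    where
    go : Path c z p → Linked (λ c d → Child d c) p → x ∈ p → x ≢ c → parent x ∈ p
    go P _ (here eq) x≢c = contradiction (trans eq (sym (head-unique P))) x≢c
    go {x = x} (step {y = d} _ _ P) l (there i) x≢c with x ≟ d
    go (step _ _ stop) (ch ∷ _) _ _ | yes refl = here (proj₁ ch)
    go (step _ _ (step _ _ _)) (ch ∷ _) _ _ | yes refl = here (proj₁ ch)
    go (step _ _ P) (_ ∷ l) (there i) _ | no x≢d = there (go P l i x≢d)

  child∈ : Child x y → x ∈ C → y ∈ C
  child∈ ch x∈C = subst (_∈ C) (proj₁ ch) (parent∈ x∈C (child≢root ch))

  depth-injective : x ∈ C → y ∈ C → depth x ≡ depth y → x ≡ y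
  depth-injective i j eq with ∈-AllPairs₂ (Linked⇒AllPairs ℕ.<-trans (Linked.map increasing spine-linked)) i j
    where
    increasing : Child y x → depth x < depth y
    increasing (_ , d) = ℕ.≤-reflexive (sym d)
  ... | inj₁ x≡y = x≡y
  ... | inj₂ (inj₁ lt) = contradiction eq (ℕ.<⇒≢ lt)
  ... | inj₂ (inj₂ lt) = contradiction (sym eq) (ℕ.<⇒≢ lt)

  private
    -- The natural number is fuel; `depth x` suffices because the climb meets the spine at the root
    -- at the latest.
    climb : ℕ → V → V
    climb zero x = x
    climb (suc k) x with x ∈? C
    ... | yes _ = x
    ... | no _ = climb k (parent x)

  -- The spine vertex at which the branch containing x is attached.
  gate : V → V
  gate x = climb (depth x) x

  gate-on : x ∈ C → gate x ≡ x
  gate-on {x} x∈C with depth x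
  ... | zero = refl
  ... | suc k with x ∈? C
  ...   | yes _ = refl
  ...   | no x∉C = contradiction x∈C x∉C

  gate-parent : x ∉ C → gate x ≡ gate (parent x)
  gate-parent {x} x∉C rewrite proj₂ (parent-adj (∉⇒≢root x∉C)) with x ∈? C
  ... | yes x∈C = contradiction x∈C x∉C
  ... | no _ = refl

  -- Induction on depth, moving outwards along a branch. Depth 0 does not occur, because the root
  -- lies on the spine.
  off-induction : ∀ {ℓ} (Q : V → Set ℓ) → (∀ {x} → x ∉ C → parent x ∈ C → Q x) →
                  (∀ {x} → x ∉ C → parent x ∉ C → Q (parent x) → Q x) → ∀ {x} → x ∉ C → Q x
  off-induction Q base ind {x} = go (depth x) refl
    where
    go : ∀ k {x} → depth x ≡ k → x ∉ C → Q x
    go zero d x∉C = contradiction (depth≡0⇒root d) (∉⇒≢root x∉C)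
    go (suc k) {x} d x∉C with parent x ∈? C
    ... | yes p∈C = base x∉C p∈C
    ... | no p∉C = ind x∉C p∉C (go k (ℕ.suc-injective (trans (sym (proj₂ (parent-adj (∉⇒≢root x∉C)))) d)) p∉C)

  gate∈ : ∀ x → gate x ∈ C
  gate∈ x with x ∈? C
  ... | yes x∈C = subst (_∈ C) (sym (gate-on x∈C)) x∈C
  ... | no x∉C = off-induction (λ x → gate x ∈ C)
    (λ x∉C p∈C → subst (_∈ C) (sym (trans (gate-parent x∉C) (gate-on p∈C))) p∈C)
    (λ x∉C _ → subst (_∈ C) (sym (gate-parent x∉C))) x∉C

  -- The spine is closed under parents, so a child of an off-spine vertex is itself off the spine
  -- and climbs through that vertex.
  gate-adj : Adj x y → x ∉ C → gate x ≡ gate y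
  gate-adj {x} {y} a x∉C with adj⇒child a
  ... | inj₁ (refl , _) = gate-parent x∉C
  ... | inj₂ ch@(refl , _) = sym (gate-parent λ y∈C → x∉C (child∈ ch y∈C))

  gate-attached : Adj x y → x ∉ C → y ∈ C → gate x ≡ y
  gate-attached a x∉C y∈C = trans (gate-adj a x∉C) (gate-on y∈C)

  attached-parent : Adj x y → x ∉ C → y ∈ C → parent x ≡ y
  attached-parent a x∉C y∈C with adj⇒child a
  ... | inj₁ (eq , _) = eq
  ... | inj₂ ch = contradiction (child∈ ch y∈C) x∉C

  child-of : x ∉ C → parent x ≡ y → Adj y x
  child-of x∉C refl = adj-sym (proj₁ (parent-adj (∉⇒≢root x∉C)))

  -- What (3) yields for a spine that cannot be lengthened: a branch splits only at its first
  -- vertex, into two, and then nothing else, not even a leaf, hangs at the same spine vertex.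
  SplitsAtSpine : Set
  SplitsAtSpine = ∀ {z} → z ∉ C → 3 ≤ degree T z →
    parent z ∈ C × degree T z ≤ 3 × (∀ {y} → y ∉ C → parent y ≡ parent z → y ≡ z)

  -- What (2) yields for such a spine; leaves attached to the spine do not count as branches.
  AtMostTwoBranches : Set
  AtMostTwoBranches = ∀ {x y z} → x ∉ C → y ∉ C → z ∉ C → parent x ∈ C →
    2 ≤ degree T x → 2 ≤ degree T y → 2 ≤ degree T z →
    parent x ≡ parent y → parent x ≡ parent z → x ≢ y → x ≢ z → y ≢ z → ⊥

-- Local structure of a two-class ordering of a tree.

module Ordering {n : ℕ} (T : Graph n) (isTree : IsTree T)
                {_≺_ : Rel (Fin n) 0ℓ} (sto : IsStrictTotalOrder _≡_ _≺_)
                {class : Fin n → Fin 2} (consistent : StronglyConsistent T _≺_ class) where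
  open Graph T renaming (sym to adj-sym)
  open Trees T isTree
  open IsStrictTotalOrder sto using (compare) renaming (trans to ≺-trans; irrefl to ≺-irrefl; _<?_ to _≺?_)

  private
    V = Fin n
    variable
      a b r s t u v w x y : V

  infix 4 _≈_ _≉_
  _≈_ _≉_ : V → V → Set
  x ≈ y = class x ≡ class y
  x ≉ y = class x ≢ class y

  ≉⇒≈ : x ≉ v → y ≉ v → x ≈ y
  ≉⇒≈ {x} {v} {y} p q with class x | class y | class v
  ... | zero | zero | _ = refl
  ... | suc zero | suc zero | _ = refl
  ... | zero | suc zero | zero = contradiction refl p
  ... | zero | suc zero | suc zero = contradiction refl q
  ... | suc zero | zero | zero = contradiction refl q
  ... | suc zero | zero | suc zero = contradiction refl p

  below-adj : r ≺ s → s ≺ t → Adj r t → r ≈ s → Adj s t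
  below-adj p q a = proj₁ (consistent p q a)

  above-adj : r ≺ s → s ≺ t → Adj r t → s ≈ t → Adj r s
  above-adj p q a = proj₂ (consistent p q a)

  -- Both halves of strong consistency apply to `s` and produce a triangle. Consequently a vertex
  -- has at most one neighbour of its own class on each side.
  edge-tight : r ≺ s → s ≺ t → Adj r t → r ≈ t → s ≈ r → ⊥
  edge-tight p q a r≈t s≈r =
    no-triangle (above-adj p q a (trans s≈r r≈t)) (below-adj p q a (sym s≈r)) a

  Above Below : V → V → Set
  Above v u = Adj v u × u ≈ v × v ≺ u
  Below v u = Adj v u × u ≈ v × u ≺ v

  above-one : AtMostOne (Above v)
  above-one {x = x} {y} (a , x≈v , v≺x) (b , y≈v , v≺y) with compare x y
  ... | tri< x≺y _ _ = ⊥-elim (edge-tight v≺x x≺y b (sym y≈v) x≈v)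
  ... | tri≈ _ x≡y _ = x≡y
  ... | tri> _ _ y≺x = ⊥-elim (edge-tight v≺y y≺x a (sym x≈v) y≈v)

  below-one : AtMostOne (Below v)
  below-one {x = x} {y} (a , x≈v , x≺v) (b , y≈v , y≺v) with compare x y
  ... | tri< x≺y _ _ = ⊥-elim (edge-tight x≺y y≺v (adj-sym a) x≈v (trans y≈v (sym x≈v)))
  ... | tri≈ _ x≡y _ = x≡y
  ... | tri> _ _ y≺x = ⊥-elim (edge-tight y≺x x≺v (adj-sym b) y≈v (trans x≈v (sym y≈v)))

  same-class : Adj v u → u ≈ v → Below v u ⊎ Above v u
  same-class {v} {u} a u≈v with compare u v
  ... | tri< u≺v _ _ = inj₁ (a , u≈v , u≺v)
  ... | tri≈ _ u≡v _ = contradiction (sym u≡v) (adj⇒≢ a)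
  ... | tri> _ _ v≺u = inj₂ (a , u≈v , v≺u)

  _≈?_ : ∀ x y → Dec (x ≈ y)
  x ≈? y = class x ≟ class y

  below? : ∀ v → Dec (∃ (Below v))
  below? v = any? λ u → adj? v u ×-dec u ≈? v ×-dec u ≺? v

  above? : ∀ v → Dec (∃ (Above v))
  above? v = any? λ u → adj? v u ×-dec u ≈? v ×-dec v ≺? u

  -- A lower neighbour w of v in the class of b confines the other neighbours of b.
  confined : Adj v b → b ≉ v → Adj v w → w ≉ v → w ≺ b → Adj b a → a ≢ v →
             (a ≈ b → a ≺ b → ⊥) × (a ≈ v → a ≺ v → ⊥)
  confined {v} {b} {w} {a} vb b≉v vw w≉v w≺b ba a≢v = same , other
    where
    w≈b : w ≈ b
    w≈b = ≉⇒≈ w≉v b≉v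

    -- The vertices `v`, `w`, `a`, `b` would form a 4-cycle, forcing `w` and `b` to coincide.
    wa-impossible : Adj w a → ⊥
    wa-impossible wa = ≺-irrefl (no-4-cycle vw wa (adj-sym ba) (adj-sym vb) (≢-sym a≢v)) w≺b

    same : a ≈ b → a ≺ b → ⊥
    same a≈b a≺b with compare a w
    ... | tri< a≺w _ _ = edge-tight a≺w w≺b (adj-sym ba) a≈b (trans w≈b (sym a≈b))
    ... | tri≈ _ refl _ = no-triangle vb ba vw
    ... | tri> _ _ w≺a with compare v a
    ...   | tri< v≺a _ _ = no-triangle vb ba (above-adj v≺a a≺b vb a≈b)
    ...   | tri≈ _ v≡a _ = a≢v (sym v≡a)
    ...   | tri> _ _ a≺v = no-triangle vb ba
            (adj-sym (below-adj w≺a a≺v (adj-sym vw) (trans w≈b (sym a≈b))))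

    other : a ≈ v → a ≺ v → ⊥
    other a≈v a≺v with compare a w
    ... | tri< a≺w _ _ = wa-impossible (adj-sym (above-adj a≺w w≺b (adj-sym ba) w≈b))
    ... | tri≈ _ refl _ = w≉v a≈v
    ... | tri> _ _ w≺a = wa-impossible (above-adj w≺a a≺v (adj-sym vw) a≈v)

module ReverseOrdering {n : ℕ} (T : Graph n) (isTree : IsTree T)
                {_≺_ : Rel (Fin n) 0ℓ} (sto : IsStrictTotalOrder _≡_ _≺_)
                {class : Fin n → Fin 2} (consistent : StronglyConsistent T _≺_ class) where
  open Graph T using () renaming (sym to adj-sym)

  -- Reversing the order exchanges the two halves of strong consistency, so every one-sided argument
  -- also holds in mirror image.
  reverse-consistent : StronglyConsistent T (flip _≺_) class
  reverse-consistent p q a with consistent q p (adj-sym a)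
  ... | f , g = (λ eq → adj-sym (g (sym eq))) , (λ eq → adj-sym (f (sym eq)))

  open Ordering T isTree (Flip.isStrictTotalOrder sto) {class} reverse-consistent public

-- Condition (2) from an ordering.

module NonLeaves {n : ℕ} (T : Graph n) (isTree : IsTree T)
                {_≺_ : Rel (Fin n) 0ℓ} (sto : IsStrictTotalOrder _≡_ _≺_)
                {class : Fin n → Fin 2} (consistent : StronglyConsistent T _≺_ class) where
  open Graph T using (Adj; adj?)
  open Trees T isTree
  open IsStrictTotalOrder sto using (compare) renaming (_<?_ to _≺?_)
  open Ordering T isTree sto {class} consistent
  private module Rev = ReverseOrdering T isTree sto {class} consistent

  -- The four places are one neighbour of the class of `v` on each side, and the two extreme
  -- neighbours of the other class.
  fewNonLeafNeighbors : ∀ v → length (nonLeafNeighbors T v) ≤ 4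
  fewNonLeafNeighbors v = nonLeafNeighbors≤ (below-one ∷ above-one ∷ lowest-one ∷ highest-one ∷ []) cover
    where
    Cross Lowest Highest : Fin n → Set
    Cross u = Adj v u × u ≉ v
    Lowest u = Cross u × ¬ (∃[ w ] (Cross w × w ≺ u))
    Highest u = Cross u × ¬ (∃[ w ] (Cross w × u ≺ w))

    lowest-one : AtMostOne Lowest
    lowest-one {x} {y} (cx , nx) (cy , ny) with compare x y
    ... | tri< x≺y _ _ = contradiction (x , cx , x≺y) ny
    ... | tri≈ _ x≡y _ = x≡y
    ... | tri> _ _ y≺x = contradiction (y , cy , y≺x) nx

    highest-one : AtMostOne Highest
    highest-one {x} {y} (cx , nx) (cy , ny) with compare x y
    ... | tri< x≺y _ _ = contradiction (y , cy , x≺y) nx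
    ... | tri≈ _ x≡y _ = x≡y
    ... | tri> _ _ y≺x = contradiction (x , cx , y≺x) ny

    cross? : ∀ u → Dec (Cross u)
    cross? u = adj? v u ×-dec ¬? (u ≈? v)

    -- A second neighbour `a` of `b` is in the class of `v` or in that of `b`. In either case
    -- `confined` with `w` keeps it from one side and the mirror image with `w′` from the other,
    -- leaving no room.
    between-leaf : ∀ {b w w′} → 2 ≤ degree T b → Cross b → Cross w → w ≺ b → Cross w′ → b ≺ w′ → ⊥
    between-leaf {b} b₂ (vb , b≉v) (vw , w≉v) w≺b (vw′ , w′≉v) b≺w′ with otherNeighbor b₂ v
    ... | a , ba , a≢v with confined vb b≉v vw w≉v w≺b ba a≢v | Rev.confined vb b≉v vw′ w′≉v b≺w′ ba a≢v | a ≈? v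
    ...   | _ , lo | _ , hi | yes a≈v with compare a v
    ...     | tri< a≺v _ _ = lo a≈v a≺v
    ...     | tri≈ _ a≡v _ = a≢v a≡v
    ...     | tri> _ _ v≺a = hi a≈v v≺a
    between-leaf {b} b₂ (vb , b≉v) _ _ _ _ | a , ba , a≢v | lo , _ | hi , _ | no a≉v with compare a b
    ... | tri< a≺b _ _ = lo (≉⇒≈ a≉v b≉v) a≺b
    ... | tri≈ _ a≡b _ = adj⇒≢ ba (sym a≡b)
    ... | tri> _ _ b≺a = hi (≉⇒≈ a≉v b≉v) b≺a

    cover : ∀ {u} → Adj v u → 2 ≤ degree T u → Any (λ Q → Q u) (Below v ∷ Above v ∷ Lowest ∷ Highest ∷ [])
    cover {u} a u₂ with u ≈? v
    ... | yes u≈v = [ here , there ∘ here ]′ (same-class a u≈v)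
    ... | no u≉v with any? (λ w → cross? w ×-dec w ≺? u)
    ...   | no none = there (there (here ((a , u≉v) , none)))
    ...   | yes (w , cw , w≺u) = there (there (there (here ((a , u≉v) ,
              λ (w′ , cw′ , u≺w′) → between-leaf u₂ (a , u≉v) cw w≺u cw′ u≺w′))))

-- Off-spine vertices crossed by a spine edge.

module Crossed {n : ℕ} (T : Graph n) (isTree : IsTree T) {ρ ζ : Fin n} {C : List (Fin n)} (spine : Paths.Path T ρ ζ C)
               {_≺_ : Rel (Fin n) 0ℓ} (sto : IsStrictTotalOrder _≡_ _≺_)
               {class : Fin n → Fin 2} (consistent : StronglyConsistent T _≺_ class)
               (crossing : ∀ {v} → v ∉ C → ∃[ r ] ∃[ t ] (r ∈ C × t ∈ C × Graph.Adj T r t × r ≺ v × v ≺ t)) where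
  open Graph T using (Adj; adj?) renaming (sym to adj-sym)
  open Trees T isTree
  open Spine T isTree spine
  open IsStrictTotalOrder sto using (compare) renaming (irrefl to ≺-irrefl; trans to ≺-trans)
  open Ordering T isTree sto {class} consistent

  private
    V = Fin n
    variable
      a b r s t u v w x y : V

  gate∉ : Adj v u → v ∉ C → gate v ≢ u → u ∉ C
  gate∉ a v∉C ≢ u∈C = ≢ (gate-attached a v∉C u∈C)

  -- Consistency makes `v` adjacent to `t`, so `v` and its off-spine neighbours all hang at `t`. A
  -- further neighbour anywhere but above `v` in the class of `v` leads to a triangle, to an
  -- attachment at a spine vertex other than `t`, or to a crowded edge within a class.
  mixed-crossing : v ∉ C → r ∈ C → t ∈ C → Adj r t → r ≺ v → v ≺ t → r ≈ v → t ≉ v → degree T v ≤ 2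
  mixed-crossing {v} {r} {t} v∉C r∈C t∈C rt r≺v v≺t r≈v t≉v =
    degree≤ {Qs = (_≡ t) ∷ Above v ∷ []} ((λ { refl refl → refl }) ∷ above-one ∷ []) cover
    where
    vt : Adj v t
    vt = below-adj r≺v v≺t rt r≈v

    gate-v : gate v ≡ t
    gate-v = gate-attached vt v∉C t∈C

    off-r : u ∉ C → gate u ≡ t → Adj u r → ⊥
    off-r u∉C gate-u ur = adj⇒≢ rt (trans (sym (gate-attached ur u∉C r∈C)) gate-u)

    below-impossible : Below v u → ⊥
    below-impossible {u} (vu , u≈v , u≺v) with compare u r
    ... | tri< u≺r _ _ = edge-tight u≺r r≺v (adj-sym vu) u≈v (trans r≈v (sym u≈v))
    ... | tri≈ _ refl _ = off-r v∉C gate-v vu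
    ... | tri> _ _ r≺u = no-triangle vu (below-adj r≺u (≺-trans u≺v v≺t) rt (trans r≈v (sym u≈v))) vt

    lower : u ∉ C → gate u ≡ t → Adj v u → u ≈ t → u ≺ t → ⊥
    lower {u} u∉C gate-u vu u≈t u≺t with compare u r
    ... | tri< u≺r _ _ = off-r u∉C gate-u (above-adj u≺r r≺v (adj-sym vu) r≈v)
    ... | tri≈ _ refl _ = u∉C r∈C
    ... | tri> _ _ r≺u = off-r u∉C gate-u (adj-sym (above-adj r≺u u≺t rt u≈t))

    -- The edge from `r` to `t` does not reach beyond `t`; a spine edge crossing `u` itself is used
    -- instead.
    upper : u ∉ C → gate u ≡ t → Adj v u → u ≈ t → t ≺ u → ⊥
    upper {u} u∉C gate-u vu u≈t t≺u with crossing u∉C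
    ... | x , y , x∈C , y∈C , xy , x≺u , u≺y with x ≈? u | y ≈? u
    ...   | yes x≈u | _ with trans (sym (gate-attached (below-adj x≺u u≺y xy x≈u) u∉C y∈C)) gate-u
    ...     | refl = ≺-irrefl refl (≺-trans t≺u u≺y)
    upper {u} u∉C gate-u vu u≈t t≺u | x , y , x∈C , y∈C , xy , x≺u , u≺y | no x≉u | yes y≈u =
      x≉u (trans (cong class (trans (sym (gate-attached (adj-sym (above-adj x≺u u≺y xy (sym y≈u))) u∉C x∈C)) gate-u)) (sym u≈t))
    upper {u} u∉C gate-u vu u≈t t≺u | x , y , x∈C , y∈C , xy , x≺u , u≺y | no x≉u | no y≉u with compare x v
    ... | tri< x≺v _ _ = edge-tight x≺v (≺-trans v≺t (≺-trans t≺u u≺y)) xy (≉⇒≈ x≉u y≉u)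
                           (≉⇒≈ (λ v≈u → t≉v (trans (sym u≈t) (sym v≈u))) x≉u)
    ... | tri≈ _ refl _ = v∉C x∈C
    ... | tri> _ _ v≺x = x≉u (trans (cong class (trans (sym (gate-attached (adj-sym (below-adj v≺x x≺u vu
                           (≉⇒≈ (λ v≈u → t≉v (trans (sym u≈t) (sym v≈u))) x≉u))) u∉C x∈C)) gate-u)) (sym u≈t))

    cover : Adj v u → Any (λ Q → Q u) ((_≡ t) ∷ Above v ∷ [])
    cover {u} vu with u ≈? v
    ... | yes u≈v = [ ⊥-elim ∘ below-impossible , there ∘ here ]′ (same-class vu u≈v)
    ... | no u≉v with compare u t
    ...   | tri≈ _ u≡t _ = here u≡t
    ...   | tri< u≺t u≢t _ = ⊥-elim (lower (gate∉ vu v∉C (λ eq → u≢t (trans (sym eq) gate-v)))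
              (trans (sym (gate-adj vu v∉C)) gate-v) vu (≉⇒≈ u≉v t≉v) u≺t)
    ...   | tri> _ u≢t t≺u = ⊥-elim (upper (gate∉ vu v∉C (λ eq → u≢t (trans (sym eq) gate-v)))
              (trans (sym (gate-adj vu v∉C)) gate-v) vu (≉⇒≈ u≉v t≉v) t≺u)

  -- Both bounds are recorded: the one on `v` gives (3a), the one on `w` gives (3b).
  Attached : V → Set
  Attached v = ∃[ w ] (w ∈ C × Adj v w × degree T w ≤ 3 × degree T v ≤ 3)

  -- The neighbour `a` cannot lie under the edge from `r` to `t`, so it is `r` or lies below `r`,
  -- and then consistency makes `v` adjacent to `r`. All other neighbours of `v` turn out to be in
  -- its own class, so degree 3 requires one on each side; these two in turn leave `r` no neighbour
  -- in that class besides `v`.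
  pure-crossing : v ∉ C → 3 ≤ degree T v → r ∈ C → t ∈ C → Adj r t → r ≺ v → v ≺ t → r ≉ v → t ≉ v →
                  Adj v a → a ≉ v → a ≺ v → Attached v
  pure-crossing {v} {r} {t} {a} v∉C v₃ r∈C t∈C rt r≺v v≺t r≉v t≉v va a≉v a≺v =
    r , r∈C , vr , degree-r , degree-v
    where
    r≈t : r ≈ t
    r≈t = ≉⇒≈ r≉v t≉v

    vr : Adj v r
    vr with compare a r
    ... | tri< a≺r _ _ = adj-sym (below-adj a≺r r≺v (adj-sym va) (≉⇒≈ a≉v r≉v)) 
    ... | tri≈ _ refl _ = va
    ... | tri> _ _ r≺a = ⊥-elim (edge-tight r≺a (≺-trans a≺v v≺t) rt r≈t (≉⇒≈ a≉v r≉v))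

    gate-v : gate v ≡ r
    gate-v = gate-attached vr v∉C r∈C

    not-t : Adj v t → ⊥
    not-t vt = adj⇒≢ rt (trans (sym gate-v) (gate-attached vt v∉C t∈C))

    lower : u ∉ C → gate u ≡ r → Adj v u → u ≉ v → u ≺ r → ⊥
    lower {u} u∉C gate-u vu u≉v u≺r with crossing u∉C
    ... | x , y , x∈C , y∈C , xy , x≺u , u≺y with x ≈? u | y ≈? u
    ...   | yes x≈u | _ with below-adj x≺u u≺y xy x≈u
    ...     | uy with trans (sym (gate-attached uy u∉C y∈C)) gate-u
    ...       | refl = no-triangle vu uy vr
    lower {u} u∉C gate-u vu u≉v u≺r | x , y , x∈C , y∈C , xy , x≺u , u≺y | no x≉u | yes y≈u
      with trans (sym (gate-attached (adj-sym (above-adj x≺u u≺y xy (sym y≈u))) u∉C x∈C)) gate-u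
    ... | refl = ≺-irrefl refl (≺-trans x≺u u≺r)
    lower {u} u∉C gate-u vu u≉v u≺r | x , y , x∈C , y∈C , xy , x≺u , u≺y | no x≉u | no y≉u with compare y v
    ... | tri< y≺v _ _ = y≉u (trans (cong class (trans (sym (gate-attached (above-adj u≺y y≺v (adj-sym vu)
                           (≉⇒≈ y≉u (≢-sym u≉v))) u∉C y∈C)) gate-u)) (≉⇒≈ r≉v u≉v))
    ... | tri≈ _ refl _ = v∉C y∈C
    ... | tri> _ _ v≺y = edge-tight (≺-trans x≺u (≺-trans u≺r r≺v)) v≺y xy (≉⇒≈ x≉u y≉u) (≉⇒≈ (≢-sym u≉v) x≉u)

    cross-only-r : Adj v u → u ≉ v → u ≡ r
    cross-only-r {u} vu u≉v with compare u r
    ... | tri< u≺r u≢r _ = ⊥-elim (lower (gate∉ vu v∉C (λ eq → u≢r (trans (sym eq) gate-v)))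
            (trans (sym (gate-adj vu v∉C)) gate-v) vu u≉v u≺r)
    ... | tri≈ _ u≡r _ = u≡r
    ... | tri> _ _ r≺u with compare u t
    ...   | tri< u≺t _ _ = ⊥-elim (edge-tight r≺u u≺t rt r≈t (≉⇒≈ u≉v r≉v))
    ...   | tri≈ _ refl _ = ⊥-elim (not-t vu)
    ...   | tri> _ _ t≺u = ⊥-elim (not-t (above-adj v≺t t≺u vu (≉⇒≈ t≉v u≉v)))

    degree-v : degree T v ≤ 3
    degree-v = degree≤ {Qs = (_≡ r) ∷ Below v ∷ Above v ∷ []}
      ((λ { refl refl → refl }) ∷ below-one ∷ above-one ∷ []) cover
      where
      cover : Adj v u → Any (λ Q → Q u) ((_≡ r) ∷ Below v ∷ Above v ∷ [])
      cover {u} vu with u ≈? v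
      ... | yes u≈v = [ there ∘ here , there ∘ there ∘ here ]′ (same-class vu u≈v)
      ... | no u≉v = here (cross-only-r vu u≉v)

    below-v : ∃ (Below v)
    below-v with below? v
    ... | yes found = found
    ... | no none = contradiction v₃ (ℕ.<⇒≱ (s≤s (degree≤ {Qs = (_≡ r) ∷ Above v ∷ []}
            ((λ { refl refl → refl }) ∷ above-one ∷ []) cover)))
      where
      cover : Adj v u → Any (λ Q → Q u) ((_≡ r) ∷ Above v ∷ [])
      cover {u} vu with u ≈? v
      ... | yes u≈v = [ (λ b → contradiction (_ , b) none) , there ∘ here ]′ (same-class vu u≈v)
      ... | no u≉v = here (cross-only-r vu u≉v)

    above-v : ∃ (Above v)
    above-v with above? v
    ... | yes found = found
    ... | no none = contradiction v₃ (ℕ.<⇒≱ (s≤s (degree≤ {Qs = (_≡ r) ∷ Below v ∷ []}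
            ((λ { refl refl → refl }) ∷ below-one ∷ []) cover)))
      where
      cover : Adj v u → Any (λ Q → Q u) ((_≡ r) ∷ Below v ∷ [])
      cover {u} vu with u ≈? v
      ... | yes u≈v = [ there ∘ here , (λ b → contradiction (_ , b) none) ]′ (same-class vu u≈v)
      ... | no u≉v = here (cross-only-r vu u≉v)

    -- Take the own-class neighbour `u` of `v` on the side of `b`. If `b` lies between `v` and `u`,
    -- an edge within a class is crowded; if `b` is beyond `u`, consistency makes `u` adjacent to
    -- `r` or to the edge's ends in such a way that `u`, `v`, `r` form a triangle.
    cross-only-v : Adj r b → b ≉ r → b ≡ v
    cross-only-v {b} rb b≉r with compare b v | b≈v | above-v | below-v
      where
      b≈v : b ≈ v
      b≈v = ≉⇒≈ b≉r (≢-sym r≉v)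
    ... | tri≈ _ b≡v _ | _ | _ | _ = b≡v
    ... | tri> _ _ v≺b | b≈v | u , vu , u≈v , v≺u | _ with compare b u
    ...   | tri< b≺u _ _ = ⊥-elim (edge-tight v≺b b≺u vu (sym u≈v) b≈v)
    ...   | tri≈ _ refl _ = ⊥-elim (no-triangle (adj-sym vr) vu rb)
    ...   | tri> _ _ u≺b = ⊥-elim (no-triangle (adj-sym vr) vu
              (above-adj (≺-trans r≺v v≺u) u≺b rb (trans u≈v (sym b≈v))))
    cross-only-v {b} rb b≉r | tri< b≺v _ _ | b≈v | _ | u , vu , u≈v , u≺v with compare b u
    ... | tri> _ _ u≺b = ⊥-elim (edge-tight u≺b b≺v (adj-sym vu) u≈v (trans b≈v (sym u≈v)))
    ... | tri≈ _ refl _ = ⊥-elim (no-triangle (adj-sym vr) vu rb)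
    ... | tri< b≺u _ _ with compare u r
    ...   | tri< u≺r _ _ = ⊥-elim (no-triangle vu (below-adj b≺u u≺r (adj-sym rb) (trans b≈v (sym u≈v))) vr)
    ...   | tri≈ _ refl _ = contradiction u≈v r≉v
    ...   | tri> _ _ r≺u = ⊥-elim (no-triangle (adj-sym vr) vu (above-adj r≺u u≺v (adj-sym vr) u≈v))

    degree-r : degree T r ≤ 3
    degree-r = degree≤ {Qs = (_≡ v) ∷ Below r ∷ Above r ∷ []}
      ((λ { refl refl → refl }) ∷ below-one ∷ above-one ∷ []) cover
      where
      cover : Adj r u → Any (λ Q → Q u) ((_≡ v) ∷ Below r ∷ Above r ∷ [])
      cover {u} ru with u ≈? r
      ... | yes u≈r = [ there ∘ here , there ∘ there ∘ here ]′ (same-class ru u≈r)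
      ... | no u≉r = here (cross-only-v ru u≉r)

-- Condition (3): the path from the least to the greatest vertex.

module Extremes {n : ℕ} (T : Graph n) (isTree : IsTree T)
                {_≺_ : Rel (Fin n) 0ℓ} (sto : IsStrictTotalOrder _≡_ _≺_)
                {class : Fin n → Fin 2} (consistent : StronglyConsistent T _≺_ class)
                {ρ ζ : Fin n} (ρ-least : ∀ v → v ≡ ρ ⊎ ρ ≺ v) (ζ-greatest : ∀ v → v ≡ ζ ⊎ v ≺ ζ)
                {C : List (Fin n)} (spine : Paths.Path T ρ ζ C) where
  open Graph T using (Adj; adj?) renaming (sym to adj-sym)
  open Trees T isTree
  open IsStrictTotalOrder sto using (compare)
  open Ordering T isTree sto {class} consistent
  private module Rev = ReverseOrdering T isTree sto {class} consistent

  -- A discrete intermediate value argument: the path starts below `v` and ends above it, so some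
  -- edge passes over `v`.
  crossing : ∀ {v} → v ∉ C → ∃[ r ] ∃[ t ] (r ∈ C × t ∈ C × Adj r t × r ≺ v × v ≺ t)
  crossing {v} v∉C = along spine v∉C
    ([ (λ { refl → contradiction (start∈ spine) v∉C }) , (λ lt → lt) ]′ (ρ-least v))
    ([ (λ { refl → contradiction (end∈ spine) v∉C }) , (λ lt → lt) ]′ (ζ-greatest v))
    where
    along : ∀ {x z p} → Path x z p → v ∉ p → x ≺ v → v ≺ z →
            ∃[ r ] ∃[ t ] (r ∈ p × t ∈ p × Adj r t × r ≺ v × v ≺ t)
    along stop _ x≺v v≺x = contradiction v≺x (IsStrictTotalOrder.asym sto x≺v)
    along (step {x} {y = y} a _ P) v∉p x≺v v≺z with compare y v
    ... | tri≈ _ refl _ = contradiction (there (start∈ P)) v∉p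
    ... | tri> _ _ v≺y = x , y , here refl , there (start∈ P) , a , x≺v , v≺y
    ... | tri< y≺v _ _ with along P (v∉p ∘ there) y≺v v≺z
    ...   | r , t , i , j , rest = r , t , there i , there j , rest

  reverse-crossing : ∀ {v} → v ∉ C → ∃[ t ] ∃[ r ] (t ∈ C × r ∈ C × Adj t r × v ≺ t × r ≺ v)
  reverse-crossing v∉C with crossing v∉C
  ... | r , t , i , j , a , p , q = t , r , j , i , adj-sym a , q , p

  private
    module Up = Crossed T isTree spine sto {class} consistent crossing
    module Down = Crossed T isTree spine (Flip.isStrictTotalOrder sto) {class} Rev.reverse-consistent
      reverse-crossing

  attached : ∀ {v} → v ∉ C → 3 ≤ degree T v → Up.Attached v
  attached {v} v∉C v₃ with crossing v∉C
  -- The cases are the number of ends of the crossing edge in the class of `v`: two contradict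
  -- `edge-tight`, one allows only degree 2, and for none a neighbour in the other class decides
  -- between the order and its reverse.
  ... | r , t , i , j , a , p , q with r ≈? v | t ≈? v
  ... | yes r≈v | yes t≈v = ⊥-elim (edge-tight p q a (trans r≈v (sym t≈v)) (sym r≈v))
  ... | yes r≈v | no t≉v = contradiction v₃ (ℕ.<⇒≱ (s≤s (Up.mixed-crossing v∉C i j a p q r≈v t≉v)))
  ... | no r≉v | yes t≈v = contradiction v₃ (ℕ.<⇒≱ (s≤s (Down.mixed-crossing v∉C j i (adj-sym a) q p t≈v r≉v)))
  ... | no r≉v | no t≉v with any? (λ u → adj? v u ×-dec ¬? (u ≈? v))
  ...   | yes (u , vu , u≉v) with compare u v
  ...     | tri< u≺v _ _ = Up.pure-crossing v∉C v₃ i j a p q r≉v t≉v vu u≉v u≺v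
  ...     | tri≈ _ refl _ = contradiction refl u≉v
  ...     | tri> _ _ v≺u = Down.pure-crossing v∉C v₃ j i (adj-sym a) q p t≉v r≉v vu u≉v v≺u
  attached {v} v∉C v₃ | r , t , i , j , a , p , q | no r≉v | no t≉v | no none =
    contradiction v₃ (ℕ.<⇒≱ (s≤s (degree≤ {Qs = Below v ∷ Above v ∷ []} (below-one ∷ above-one ∷ []) cover)))
    where
    cover : ∀ {u} → Adj v u → Any (λ Q → Q u) (Below v ∷ Above v ∷ [])
    cover {u} vu with u ≈? v
    ... | yes u≈v = [ here , there ∘ here ]′ (same-class vu u≈v)
    ... | no u≉v = contradiction (u , vu , u≉v) none

  hasSpine : HasSpine T
  hasSpine = C , path-simple spine , big , cubic
    where
    big : ∀ v → 4 ≤ degree T v → v ∈ C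
    big v v₄ with v ∈? C
    ... | yes v∈C = v∈C
    ... | no v∉C with attached v∉C (ℕ.<⇒≤ v₄)
    ...   | _ , _ , _ , _ , v≤3 = contradiction v₄ (ℕ.<⇒≱ (s≤s v≤3))

    cubic : ∀ v → degree T v ≡ 3 → v ∉ C → ∃[ w ] (w ∈ C × Adj v w × degree T w ≤ 3)
    cubic v v≡3 v∉C with attached v∉C (ℕ.≤-reflexive (sym v≡3))
    ... | w , w∈C , a , w≤3 , _ = w , w∈C , a , w≤3

-- Least elements and pulled-back orders.

least : ∀ {n} {_≺_ : Rel (Fin n) 0ℓ} → IsStrictTotalOrder _≡_ _≺_ → 1 ≤ n → ∃[ m ] (∀ v → v ≡ m ⊎ m ≺ v)
least {suc n} {_≺_} sto _ with go (allFin (suc n))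
  where
  open IsStrictTotalOrder sto using (compare) renaming (trans to ≺-trans)
  go : ∀ vs → ∃[ m ] (∀ {v} → v ∈ vs → v ≡ m ⊎ m ≺ v)
  go [] = zero , λ ()
  go (x ∷ vs) with go vs
  ... | m , lo with compare x m
  ...   | tri< x≺m _ _ = x , λ { (here eq) → inj₁ eq
                               ; (there i) → inj₂ ([ (λ { refl → x≺m }) , ≺-trans x≺m ]′ (lo i)) }
  ...   | tri≈ _ x≡m _ = m , λ { (here refl) → inj₁ x≡m ; (there i) → lo i }
  ...   | tri> _ _ m≺x = m , λ { (here refl) → inj₂ m≺x ; (there i) → lo i }
... | m , lo = m , λ v → lo (∈-allFin v)

strictTotalOrder-on : ∀ {A B : Set} {_≈_ _<_ : Rel B 0ℓ} (f : A → B) → (∀ {x y} → f x ≈ f y → x ≡ y) →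
                      IsStrictTotalOrder _≈_ _<_ → IsStrictTotalOrder _≡_ (_<_ on f)
strictTotalOrder-on {_<_ = _<_} f f-inj sto = record
  { isStrictPartialOrder = record
    { isEquivalence = isEquivalence
    ; irrefl        = λ { refl → S.irrefl S.Eq.refl }
    ; trans         = S.trans
    ; <-resp-≈      = (λ { refl lt → lt }) , (λ { refl lt → lt })
    }
  ; compare = λ x y → case S.compare (f x) (f y) of λ where
      (tri< lt ≉ ≯) → tri< lt (≉ ∘ λ { refl → S.Eq.refl }) ≯
      (tri≈ ≮ eq ≯) → tri≈ ≮ (f-inj eq) ≯
      (tri> ≮ ≉ gt) → tri> ≮ (≉ ∘ λ { refl → S.Eq.refl }) gt
  }
  where module S = IsStrictTotalOrder sto

-- Improving a path until it is maximal.

module Extension {n : ℕ} (T : Graph n) (isTree : IsTree T) where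
  open Graph T renaming (sym to adj-sym)
  open Trees T isTree
  open IsTree isTree

  private
    V = Fin n
    variable
      c x y z u v : V
      p C : List V

  path-length≤ : Path x z p → length p ≤ n
  path-length≤ {p = p} P = subst (length p ≤_) (length-tabulate {n = n} (λ i → i))
    (length-⊆ (path-unique P) (λ _ → ∈-allFin _))

  -- Each improvement lengthens the list while lengths stay at most `n`. The fuel `k` is an upper
  -- bound for the room left.
  extend-maximally : ∀ {Good : List V → Set} {Goal : Set} → (∀ {C} → Good C → length C ≤ n) →
    (∀ {C} → Good C → Goal ⊎ ∃[ C′ ] (Good C′ × length C < length C′)) → Good C → Goal
  extend-maximally {Good = Good} {Goal} bound improve = go n (ℕ.m≤m+n n _)
    where
    go : ∀ k {C} → n ≤ k + length C → Good C → Goal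
    go k n≤ good with improve good
    ... | inj₁ goal = goal
    go zero n≤ good | inj₂ (_ , good′ , lt) = contradiction (ℕ.≤-trans lt (bound good′)) (ℕ.≤⇒≯ n≤)
    go (suc k) {C} n≤ good | inj₂ (C′ , good′ , lt) = go k (ℕ.≤-trans n≤
      (ℕ.≤-trans (ℕ.≤-reflexive (sym (ℕ.+-suc k (length C)))) (ℕ.+-monoʳ-≤ k lt))) good′

  -- By `path-extend`, only the second vertex of a path can be a neighbour of the first one on it.
  chord-one : Path x z p → AtMostOne (λ u → Adj x u × u ∈ p)
  chord-one stop (a , here refl) _ = contradiction refl (adj⇒≢ a)
  chord-one P@(step {y = y} _ _ Q) (a , i) (b , j) = trans (second P Q a i) (sym (second P Q b j))
    where
    second : Path x z (x ∷ p) → Path y z p → Adj x u → u ∈ x ∷ p → u ≡ y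
    second {u = u} P Q a i with u ≟ y
    second P stop a i | yes eq = eq
    second P stop a i | no u≢y = contradiction i (path-extend P (adj-sym a) u≢y)
    second P (step _ _ _) a i | yes eq = eq
    second P (step _ _ _) a i | no u≢y = contradiction i (path-extend P (adj-sym a) u≢y)

  closed-start⇒leaf : Path x z p → (∀ {u} → Adj x u → u ∈ p) → degree T x ≤ 1
  closed-start⇒leaf P closed = degree≤ (chord-one P ∷ []) (λ a → here (a , closed a))

  -- The first vertex of a path that cannot be extended there has all its neighbours on the path,
  -- hence at most one.
  leaf-exists : ∃[ x ] degree T x ≤ 1
  leaf-exists with nonempty
  ... | s≤s {n = m} _ = extend-maximally {C = zero ∷ []} {Good = λ C → ∃[ x ] ∃[ z ] Path x z C}
    (λ (_ , _ , P) → path-length≤ P) improve (_ , _ , stop)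
    where
    improve : (∃[ x ] ∃[ z ] Path x z C) →
              (∃[ x ] degree T x ≤ 1) ⊎ ∃[ C′ ] ((∃[ x ] ∃[ z ] Path x z C′) × length C < length C′)
    improve {C} (x , z , P) with any? (λ u → adj? x u ×-dec ¬? (u ∈? C))
    ... | yes (u , a , u∉) = inj₂ (u ∷ C , (u , z , step (adj-sym a) u∉ P) , ℕ.≤-refl)
    ... | no none = inj₁ (x , closed-start⇒leaf P λ {u} a → decidable-stable (u ∈? C) λ u∉ → none (u , a , u∉))

-- Trees of maximum degree at most 2.

module LinearTree {n : ℕ} (T : Graph n) (isTree : IsTree T) (low : ∀ v → degree T v ≤ 2) where
  open Graph T renaming (sym to adj-sym)
  open Trees T isTree
  open Extension T isTree

  private
    ρ = proj₁ leaf-exists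
  open Rooted T isTree ρ

  private
    V = Fin n
    variable
      x y : V

  -- The root has degree at most 1, and any other vertex spends one of its two edges on its own
  -- parent; so there is room for one child only.
  siblings-equal : parent x ≡ parent y → x ≢ ρ → y ≢ ρ → x ≡ y
  siblings-equal {x} {y} eq x≢ρ y≢ρ with x ≟ y | parent-adj x≢ρ | parent-adj y≢ρ
  ... | yes x≡y | _ | _ = x≡y
  ... | no x≢y | a , dx | b , dy with parent x ≟ ρ
  ...   | yes p≡ρ = contradiction (proj₂ leaf-exists) (ℕ.<⇒≱ (≤degree {us = x ∷ y ∷ []}
            ((x≢y ∷ []) ∷ [] ∷ [])
            (subst (λ p → Adj p x) p≡ρ (adj-sym a) ∷ subst (λ p → Adj p y) (trans (sym eq) p≡ρ) (adj-sym b) ∷ [])))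
  ...   | no p≢ρ with parent-adj p≢ρ
  ...     | c , dp = contradiction (low (parent x)) (ℕ.<⇒≱ (≤degree {us = parent (parent x) ∷ x ∷ y ∷ []}
              ((above dx ∷ above (trans dy (cong {B = ℕ} (λ p → suc (depth p)) (sym eq))) ∷ []) ∷ (x≢y ∷ []) ∷ [] ∷ [])
              (c ∷ adj-sym a ∷ subst (λ p → Adj p y) (sym eq) (adj-sym b) ∷ [])))
    where
    above : ∀ {w} → depth w ≡ suc (depth (parent x)) → parent (parent x) ≢ w
    above d refl = ℕ.<⇒≢ (ℕ.m<n⇒m<1+n ℕ.≤-refl) (trans d (cong suc dp))

  depth-injective : ∀ k → depth x ≡ k → depth y ≡ k → x ≡ y
  depth-injective zero dx dy = trans (depth≡0⇒root dx) (sym (depth≡0⇒root dy))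
  depth-injective {x} {y} (suc k) dx dy = siblings-equal
    (depth-injective k (step-down dx) (step-down dy)) (deep dx) (deep dy)
    where
    deep : ∀ {v} → depth v ≡ suc k → v ≢ ρ
    deep d refl with () ← trans (sym depth-root) d
    step-down : ∀ {v} → depth v ≡ suc k → depth (parent v) ≡ k
    step-down d = ℕ.suc-injective (trans (sym (proj₂ (parent-adj (deep d)))) d)

  -- Ordering by depth makes adjacent vertices consecutive, so no triple tests consistency.
  properThin : ProperThin T 1
  properThin = (_<_ on depth) , (λ _ → zero) ,
    strictTotalOrder-on depth (λ {x} eq → depth-injective (depth x) refl (sym eq)) ℕ.<-isStrictTotalOrder ,
    (λ { zero → ρ , refl }) , λ p q a → ⊥-elim (adjacent p q (adj⇒child a))
    where
    adjacent : ∀ {r s t} → depth r < depth s → depth s < depth t → Child r t ⊎ Child t r → ⊥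
    adjacent p q (inj₁ (_ , d)) = ℕ.<⇒≱ (ℕ.<-trans p q) (ℕ.≤-trans (ℕ.n≤1+n _) (ℕ.≤-reflexive (sym d)))
    adjacent p q (inj₂ (_ , d)) = ℕ.<⇒≱ p (ℕ.≤-pred (ℕ.≤-trans q (ℕ.≤-reflexive d)))

-- Spines that cannot be lengthened.

module Spines {n : ℕ} (T : Graph n) (isTree : IsTree T) where
  open Graph T renaming (sym to adj-sym)
  open Trees T isTree
  open Extension T isTree

  private
    V = Fin n
    variable
      c d x z u v w : V
      p C : List V

  Covers : List V → Set
  Covers C = (∀ v → 4 ≤ degree T v → v ∈ C) ×
             (∀ v → degree T v ≡ 3 → v ∉ C → ∃[ w ] (w ∈ C × Adj v w × degree T w ≤ 3))

  IsSpine : List V → Set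
  IsSpine C = (∃[ x ] ∃[ z ] Path x z C) × Covers C

  -- The failure of both ways to lengthen at the start: prepending a neighbour of the first vertex,
  -- or trading the first vertex for two vertices of a branch at the second.
  FullStart : List V → Set
  FullStart C = (∀ {c p} → C ≡ c ∷ p → ∀ {u} → Adj c u → u ∈ C) ×
                (∀ {c d p} → C ≡ c ∷ d ∷ p → ∀ {u} → Adj d u → u ∉ C → degree T u ≤ 1)

  covers-mono : ∀ {C D} → (∀ {v} → v ∈ C → 3 ≤ degree T v → v ∈ D) →
                (∀ {v w} → v ∉ C → 3 ≤ degree T v → w ∈ C → Adj w v → w ∈ D) → Covers C → Covers D
  covers-mono {C} big nbr (c₄ , c₃) =
    (λ v v₄ → big (c₄ v v₄) (ℕ.<⇒≤ v₄)) ,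
    (λ v v≡3 v∉D → let v₃ = ℕ.≤-reflexive (sym v≡3)
                       v∉C = λ v∈C → v∉D (big v∈C v₃)
                       (w , w∈C , a , w≤3) = c₃ v v≡3 v∉C
                   in w , nbr v∉C v₃ w∈C (adj-sym a) , a , w≤3)

  -- With no neighbour off the path, `c` is a leaf, and no off-spine vertex is attached to it.
  -- Dropping it therefore preserves (3), and `u′`, `u` take its place.
  lengthen-second : Path c z (c ∷ p) → Covers (c ∷ p) → (∀ {u} → Adj c u → u ∈ c ∷ p) →
           FullStart (c ∷ p) ⊎ ∃[ C′ ] (IsSpine C′ × length (c ∷ p) < length C′)
  lengthen-second {p = []} _ _ closed = inj₁ ((λ { refl → closed }) , λ ())
  lengthen-second {c = c} {p = d ∷ ds} P@(step _ _ _) (cov) closed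
    with any? (λ u → adj? d u ×-dec ¬? (u ∈? c ∷ d ∷ ds) ×-dec 2 ℕ.≤? degree T u)
  ... | no none = inj₁ ((λ { refl → closed }) , λ { refl {u} a u∉ →
          ℕ.≤-pred (ℕ.≰⇒> λ u₂ → none (u , a , u∉ , u₂)) })
  ... | yes (u , a , u∉ , u₂) with otherNeighbor u₂ d
  ...   | u′ , a′ , u′≢d = inj₂ (_ , ((u′ , _ , step (adj-sym a′) (path-extend Q (adj-sym a′) u′≢d) Q) ,
            covers-mono big nbr cov) , ℕ.≤-refl)
    where
    Q = step (adj-sym a) (u∉ ∘ there) (path-tail P)
    big : v ∈ c ∷ d ∷ ds → 3 ≤ degree T v → v ∈ u′ ∷ u ∷ d ∷ ds
    big (here refl) v₃ = contradiction (ℕ.<⇒≤ v₃) (ℕ.<⇒≱ (s≤s (closed-start⇒leaf P closed)))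
    big (there i) _ = there (there i)
    nbr : v ∉ c ∷ d ∷ ds → 3 ≤ degree T v → w ∈ c ∷ d ∷ ds → Adj w v → w ∈ u′ ∷ u ∷ d ∷ ds
    nbr v∉ _ (here refl) a = contradiction (closed a) v∉
    nbr _ _ (there i) _ = there (there i)

  lengthen : IsSpine C → FullStart C ⊎ ∃[ C′ ] (IsSpine C′ × length C < length C′)
  lengthen {[]} ((_ , _ , ()) , _)
  lengthen {c ∷ cs} ((x , z , P) , cov) with refl ← head-unique P with any? (λ u → adj? c u ×-dec ¬? (u ∈? c ∷ cs))
  ... | yes (u , a , u∉) = inj₂ (_ , ((u , z , step (adj-sym a) u∉ P) ,
          covers-mono (λ i _ → there i) (λ _ _ i _ → there i) cov) , ℕ.≤-refl)
  ... | no none = lengthen-second P cov closed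
    where
    closed : Adj c u → u ∈ c ∷ cs
    closed {u} a = decidable-stable (u ∈? c ∷ cs) λ u∉ → none (u , a , u∉)

  reverse-spine : IsSpine C → IsSpine (reverse C)
  reverse-spine ((x , z , P) , cov) = (z , x , path-reverse P) ,
    covers-mono (λ i _ → reverse⁺ i) (λ _ _ i _ → reverse⁺ i) cov

  Maximal : List V → Set
  Maximal C = IsSpine C × FullStart C × FullStart (reverse C)

  maximal-spine : HasSpine T → ∃ Maximal
  maximal-spine (C , simple , c₄ , c₃) = extend-maximally {Good = IsSpine}
    (λ ((_ , _ , P) , _) → path-length≤ P) improve (simple-path simple , c₄ , c₃)
    where
    improve : ∀ {C} → IsSpine C → ∃ Maximal ⊎ ∃[ C′ ] (IsSpine C′ × length C < length C′)
    improve {C} s with lengthen s | lengthen (reverse-spine s)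
    ... | inj₂ longer | _ = inj₂ longer
    ... | inj₁ full | inj₁ full′ = inj₁ (C , s , full , full′)
    ... | inj₁ _ | inj₂ (C′ , s′ , lt) = inj₂ (C′ , s′ , subst (_< length C′) (length-reverse C) lt)

  -- The entries before `c` are listed backwards, so both sides start next to `c` and reversing the
  -- spine exchanges `as` with `bs`.
  zipper : c ∈ C → ∃[ as ] ∃[ bs ] as ʳ++ (c ∷ bs) ≡ C
  zipper (here refl) = [] , _ , refl
  zipper {C = x ∷ _} (there i) with zipper i
  ... | as , bs , refl = as ++ x ∷ [] , bs , ++-ʳ++ as

  -- In a maximal spine the ends are `closed` and the vertices next to them `leafy`. All others have
  -- two spine vertices on each side, so that their spine neighbours are not leaves.
  data Role (C : List V) (c : V) : Set where
    closed   : (∀ {u} → Adj c u → u ∈ C) → Role C c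
    leafy    : (∀ {u} → Adj c u → u ∉ C → degree T u ≤ 1) → Role C c
    interior : ∀ {c′ c″} → c′ ∈ C → c″ ∈ C → c′ ≢ c″ → Adj c c′ → Adj c c″ →
               2 ≤ degree T c′ → 2 ≤ degree T c″ → Role C c

  interior-role : ∀ as {bs c′ a c″ b} → Path x z (as ʳ++ (a ∷ c′ ∷ c ∷ c″ ∷ b ∷ bs)) →
                  Role (as ʳ++ (a ∷ c′ ∷ c ∷ c″ ∷ b ∷ bs)) c
  interior-role {z = z} {c = c} as {bs} {c′} {a} {c″} {b} P = from (path-ʳ++⁻ as P)
    where
    from : Path a z (a ∷ c′ ∷ c ∷ c″ ∷ b ∷ bs) → Role (as ʳ++ (a ∷ c′ ∷ c ∷ c″ ∷ b ∷ bs)) c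
    from P₀@(step _ a∉ _) with path-tail P₀
    ... | P₁@(step _ c′∉ _) with path-tail P₁
    ...   | P₂@(step _ c∉ _) with path-tail P₂
    ...     | P₃ = interior
      (reverseAcc⁺ _ as (inj₁ (there (here refl)))) (reverseAcc⁺ _ as (inj₁ (there (there (there (here refl))))))
      (λ eq → c′∉ (there (here eq))) (adj-sym (path-second P₁)) (path-second P₂)
      (≤degree {us = a ∷ c ∷ []} (((λ eq → a∉ (there (here eq))) ∷ []) ∷ [] ∷ [])
        (adj-sym (path-second P₀) ∷ path-second P₁ ∷ []))
      (≤degree {us = c ∷ b ∷ []} (((λ eq → c∉ (there (here eq))) ∷ []) ∷ [] ∷ [])
        (adj-sym (path-second P₂) ∷ path-second P₃ ∷ []))

  role : Maximal C → c ∈ C → Role C c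
  role {C} {c} (((_ , _ , P) , _) , full , full′) c∈C with zipper c∈C
  ... | as , bs , refl = go as bs P full (subst FullStart reversed full′)
          (λ i → reverse⁻ (subst (_ ∈_) (sym reversed) i))
    where
    reversed : reverse (as ʳ++ (c ∷ bs)) ≡ bs ʳ++ (c ∷ as)
    reversed = trans (ʳ++-ʳ++ as) (cong (λ as → bs ʳ++ (c ∷ as)) (++-identityʳ as))

    go : ∀ as bs → Path x z (as ʳ++ (c ∷ bs)) → FullStart (as ʳ++ (c ∷ bs)) → FullStart (bs ʳ++ (c ∷ as)) →
         (∀ {u} → u ∈ bs ʳ++ (c ∷ as) → u ∈ as ʳ++ (c ∷ bs)) → Role (as ʳ++ (c ∷ bs)) c
    go [] _ _ (f , _) _ _ = closed (f refl)
    go (_ ∷ _) [] _ _ (f , _) to = closed (to ∘ f refl)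
    go (_ ∷ []) (_ ∷ _) _ (_ , f) _ _ = leafy (f refl)
    go (_ ∷ _ ∷ _) (_ ∷ []) _ _ (_ , f) to = leafy λ a u∉ → f refl a (u∉ ∘ to)
    go (_ ∷ _ ∷ as) (_ ∷ _ ∷ bs) P _ _ _ = interior-role as P

-- The layout of the branches around a spine.

data Side : Set where
  left middle right : Side

module Layout {n : ℕ} (T : Graph n) (isTree : IsTree T) {ρ ζ : Fin n} {C : List (Fin n)}
  (spine : Paths.Path T ρ ζ C)
  (fork : Spine.SplitsAtSpine T isTree spine)
  (two-branches : Spine.AtMostTwoBranches T isTree spine) where
  open Graph T renaming (sym to adj-sym)
  open Trees T isTree
  open Spine T isTree spine

  private
    V = Fin n
    variable
      p x y z s : V

  off-parent : x ∉ C → Adj x (parent x)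
  off-parent x∉C = proj₁ (parent-adj (∉⇒≢root x∉C))

  off-depth : x ∉ C → depth x ≡ suc (depth (parent x))
  off-depth x∉C = proj₂ (parent-adj (∉⇒≢root x∉C))

  grandparent≢ : x ∉ C → p ∉ C → parent x ≡ p → parent p ≢ x
  grandparent≢ {x} x∉C p∉C refl eq = ℕ.<⇒≢ (ℕ.m<n⇒m<1+n ℕ.≤-refl)
    (trans (cong depth eq) (trans (off-depth x∉C) (cong suc (off-depth p∉C))))

  parent∉⇒2≤ : x ∉ C → parent x ∉ C → 2 ≤ degree T (parent x)
  parent∉⇒2≤ {x} x∉C p∉C = ≤degree {us = parent (parent x) ∷ x ∷ []}
    ((grandparent≢ x∉C p∉C refl ∷ []) ∷ [] ∷ []) (off-parent p∉C ∷ adj-sym (off-parent x∉C) ∷ [])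

  -- The vertices that compete with their siblings for a side; leaves attached to the spine are
  -- exempt.
  Branch : V → Set
  Branch x = x ∉ C × (parent x ∈ C → 2 ≤ degree T x)

  branch? : ∀ x → Dec (Branch x)
  branch? x = ¬? (x ∈? C) ×-dec (parent x ∈? C →-dec 2 ℕ.≤? degree T x)

  -- At a spine vertex this is the hypothesis on branches. Elsewhere three children and a parent
  -- would exceed the degree 3 allowed off the spine.
  no-three-branches : Branch x → Branch y → Branch z → parent x ≡ parent y → parent x ≡ parent z →
                      x ≢ y → x ≢ z → y ≢ z → ⊥
  no-three-branches {x} {y} {z} (x∉C , bx) (y∉C , by) (z∉C , bz) px≡py px≡pz x≢y x≢z y≢z with parent x ∈? C
  ... | yes p∈C = two-branches x∉C y∉C z∉C p∈C (bx p∈C) (by (subst (_∈ C) px≡py p∈C)) (bz (subst (_∈ C) px≡pz p∈C))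
                    px≡py px≡pz x≢y x≢z y≢z
  ... | no p∉C = contradiction (proj₁ (proj₂ (fork p∉C (ℕ.<⇒≤ four)))) (ℕ.<⇒≱ four)
    where
    four : 4 ≤ degree T (parent x)
    four = ≤degree {us = parent (parent x) ∷ x ∷ y ∷ z ∷ []}
      ( (grandparent≢ x∉C p∉C refl ∷ grandparent≢ y∉C p∉C (sym px≡py) ∷ grandparent≢ z∉C p∉C (sym px≡pz) ∷ [])
      ∷ (x≢y ∷ x≢z ∷ []) ∷ (y≢z ∷ []) ∷ [] ∷ [])
      (off-parent p∉C ∷ child-of x∉C refl ∷ child-of y∉C (sym px≡py) ∷ child-of z∉C (sym px≡pz) ∷ [])

  EarlierSibling : V → V → Set
  EarlierSibling x y = Branch y × parent y ≡ parent x × toℕ y < toℕ x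

  earlier? : ∀ x → Dec (∃ (EarlierSibling x))
  earlier? x = any? λ y → branch? y ×-dec parent y ≟ parent x ×-dec toℕ y ℕ.<? toℕ x

  rank : V → Side
  rank x with earlier? x
  ... | no _ = left
  ... | yes _ = right

  rank≢middle : rank x ≢ middle
  rank≢middle {x} eq with earlier? x
  rank≢middle () | no _
  rank≢middle () | yes _

  -- Needed to put a splitting vertex on the left, so that only its right child has to jump over the
  -- spine vertex.
  sole-branch-left : (∀ {y} → Branch y → parent y ≡ parent x → y ≡ x) → rank x ≡ left
  sole-branch-left {x} sole with earlier? x
  ... | no _ = refl
  ... | yes (y , by , eq , lt) = contradiction (cong toℕ (sole by eq)) (ℕ.<⇒≢ lt)

  rank-injective : Branch x → Branch y → parent x ≡ parent y → rank x ≡ rank y → x ≡ y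
  rank-injective {x} {y} bx by px≡py eq with ℕ.<-cmp (toℕ x) (toℕ y) | earlier? x | earlier? y
  ... | tri≈ _ x≡y _ | _ | _ = toℕ-injective x≡y
  ... | tri< x<y _ _ | no _ | no none = contradiction (x , bx , px≡py , x<y) none
  ... | tri> _ _ y<x | no none | no _ = contradiction (y , by , sym px≡py , y<x) none
  -- Two branches on the right and the sibling preceding both would be three.
  ... | tri< x<y _ _ | yes (w , bw , pw , w<x) | yes _ = ⊥-elim (no-three-branches bw bx by pw (trans pw px≡py)
          (ℕ.<⇒≢ w<x ∘ cong toℕ) (ℕ.<⇒≢ (ℕ.<-trans w<x x<y) ∘ cong toℕ) (ℕ.<⇒≢ x<y ∘ cong toℕ))
  ... | tri> _ _ y<x | yes _ | yes (w , bw , pw , w<y) = ⊥-elim (no-three-branches bw by bx pw (trans pw (sym px≡py))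
          (ℕ.<⇒≢ w<y ∘ cong toℕ) (ℕ.<⇒≢ (ℕ.<-trans w<y y<x) ∘ cong toℕ) (ℕ.<⇒≢ y<x ∘ cong toℕ))

  private
    -- Recursion towards the spine with fuel. Started with `depth x`, the zero case is reached only
    -- at the root, where the value is a default.
    sideWithin : ℕ → V → Side
    sideWithin zero _ = middle
    sideWithin (suc k) x with parent x ∈? C
    ... | yes _ with degree T x ℕ.≤? 1
    ...   | yes _ = middle
    ...   | no _ = rank x
    sideWithin (suc k) x | no _ with degree T (parent x) ℕ.≤? 2
    ...   | yes _ = sideWithin k (parent x)
    ...   | no _ = rank x

    heightWithin : ℕ → V → ℕ
    heightWithin zero _ = 0
    heightWithin (suc k) x with x ∈? C
    ... | yes _ = 0
    ... | no _ = suc (heightWithin k (parent x))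

  -- Leaves attached to the spine lie in the middle of their block, the other
  -- branches to the left or to the right of it; a branch splits at a vertex of degree 3.
  side : V → Side
  side x = sideWithin (depth x) x

  height : V → ℕ
  height x = heightWithin (depth x) x

  side-leaf : x ∉ C → parent x ∈ C → degree T x ≤ 1 → side x ≡ middle
  side-leaf {x} x∉C p∈C x≤1 rewrite off-depth x∉C with parent x ∈? C
  ... | no p∉C = contradiction p∈C p∉C
  ... | yes _ with degree T x ℕ.≤? 1
  ...   | yes _ = refl
  ...   | no x≰1 = contradiction x≤1 x≰1

  side-start : x ∉ C → parent x ∈ C → 2 ≤ degree T x → side x ≡ rank x
  side-start {x} x∉C p∈C x₂ rewrite off-depth x∉C with parent x ∈? C
  ... | no p∉C = contradiction p∈C p∉C
  ... | yes _ with degree T x ℕ.≤? 1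
  ...   | yes x≤1 = contradiction x₂ (ℕ.<⇒≱ (s≤s x≤1))
  ...   | no _ = refl

  side-inherit : x ∉ C → parent x ∉ C → degree T (parent x) ≤ 2 → side x ≡ side (parent x)
  side-inherit {x} x∉C p∉C p≤2 rewrite off-depth x∉C with parent x ∈? C
  ... | yes p∈C = contradiction p∈C p∉C
  ... | no _ with degree T (parent x) ℕ.≤? 2
  ...   | yes _ = refl
  ...   | no p≰2 = contradiction p≤2 p≰2

  side-fork : x ∉ C → parent x ∉ C → 3 ≤ degree T (parent x) → side x ≡ rank x
  side-fork {x} x∉C p∉C p₃ rewrite off-depth x∉C with parent x ∈? C
  ... | yes p∈C = contradiction p∈C p∉C
  ... | no _ with degree T (parent x) ℕ.≤? 2
  ...   | yes p≤2 = contradiction p₃ (ℕ.<⇒≱ (s≤s p≤2))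
  ...   | no _ = refl

  middle⇒leaf : x ∉ C → side x ≡ middle → parent x ∈ C × degree T x ≤ 1
  middle⇒leaf = off-induction (λ x → side x ≡ middle → parent x ∈ C × degree T x ≤ 1) base ind
    where
    base : x ∉ C → parent x ∈ C → side x ≡ middle → parent x ∈ C × degree T x ≤ 1
    base {x} x∉C p∈C eq with degree T x ℕ.≤? 1
    ... | yes x≤1 = p∈C , x≤1
    ... | no x≰1 = contradiction (trans (sym (side-start x∉C p∈C (ℕ.≰⇒> x≰1))) eq) rank≢middle
    ind : x ∉ C → parent x ∉ C → (side (parent x) ≡ middle → parent (parent x) ∈ C × degree T (parent x) ≤ 1) →
          side x ≡ middle → parent x ∈ C × degree T x ≤ 1
    ind {x} x∉C p∉C h eq with degree T (parent x) ℕ.≤? 2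
    ... | yes p≤2 = contradiction (proj₂ (h (trans (sym (side-inherit x∉C p∉C p≤2)) eq)))
                      (ℕ.<⇒≱ (parent∉⇒2≤ x∉C p∉C))
    ... | no p≰2 = contradiction (trans (sym (side-fork x∉C p∉C (ℕ.≰⇒> p≰2))) eq) rank≢middle

  height-on : x ∈ C → height x ≡ 0
  height-on {x} x∈C with depth x
  ... | zero = refl
  ... | suc _ with x ∈? C
  ...   | yes _ = refl
  ...   | no x∉C = contradiction x∈C x∉C

  height-off : x ∉ C → height x ≡ suc (height (parent x))
  height-off {x} x∉C rewrite off-depth x∉C with x ∈? C
  ... | yes x∈C = contradiction x∈C x∉C
  ... | no _ = refl

  height≡0⇒on : height x ≡ 0 → x ∈ C
  height≡0⇒on {x} eq with x ∈? C
  ... | yes x∈C = x∈C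
  ... | no x∉C with () ← trans (sym eq) (height-off x∉C)

  height-start : x ∉ C → parent x ∈ C → height x ≡ 1
  height-start x∉C p∈C = trans (height-off x∉C) (cong suc (height-on p∈C))

  height≡1⇒start : x ∉ C → height x ≡ 1 → parent x ∈ C
  height≡1⇒start x∉C eq = height≡0⇒on (ℕ.suc-injective (trans (sym (height-off x∉C)) eq))

  start-parent : x ∉ C → parent x ∈ C → parent x ≡ gate x
  start-parent x∉C p∈C = sym (trans (gate-parent x∉C) (gate-on p∈C))

  not-middle⇒2≤ : x ∉ C → parent x ∈ C → side x ≢ middle → 2 ≤ degree T x
  not-middle⇒2≤ x∉C p∈C ≢m = ℕ.≰⇒> (≢m ∘ side-leaf x∉C p∈C)

  -- Outward induction. Ranks separate the branches at the spine and the two children of a splitting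
  -- vertex, which is alone at its gate and height; a vertex of degree 2 passes its side to its only
  -- child.
  position-injective : x ∉ C → y ∉ C → gate x ≡ gate y → height x ≡ height y →
                       side x ≡ side y → side x ≢ middle → x ≡ y
  position-injective x∉C = off-induction
    (λ x → ∀ {y} → y ∉ C → gate x ≡ gate y → height x ≡ height y → side x ≡ side y → side x ≢ middle → x ≡ y)
    base ind x∉C
    where
    base : x ∉ C → parent x ∈ C → ∀ {y} → y ∉ C → gate x ≡ gate y → height x ≡ height y →
           side x ≡ side y → side x ≢ middle → x ≡ y
    base {x} x∉C p∈C {y} y∉C g h s ≢m = rank-injective (x∉C , λ _ → x₂) (y∉C , λ _ → y₂)
      (trans (start-parent x∉C p∈C) (trans g (sym (start-parent y∉C q∈C))))
      (trans (sym (side-start x∉C p∈C x₂)) (trans s (side-start y∉C q∈C y₂)))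
      where
      q∈C = height≡1⇒start y∉C (trans (sym h) (height-start x∉C p∈C))
      x₂ = not-middle⇒2≤ x∉C p∈C ≢m
      y₂ = not-middle⇒2≤ y∉C q∈C (≢m ∘ trans s)

    ind : x ∉ C → parent x ∉ C →
          (∀ {y} → y ∉ C → gate (parent x) ≡ gate y → height (parent x) ≡ height y →
                   side (parent x) ≡ side y → side (parent x) ≢ middle → parent x ≡ y) →
          ∀ {y} → y ∉ C → gate x ≡ gate y → height x ≡ height y → side x ≡ side y → side x ≢ middle → x ≡ y
    ind {x} x∉C p∉C hyp {y} y∉C g h s ≢m = same-parent parents
      where
      heights : height (parent x) ≡ height (parent y)
      heights = ℕ.suc-injective (trans (sym (height-off x∉C)) (trans h (height-off y∉C)))

      gates : gate (parent x) ≡ gate (parent y)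
      gates = trans (sym (gate-parent x∉C)) (trans g (gate-parent y∉C))

      q∉C : parent y ∉ C
      q∉C q∈C = p∉C (height≡0⇒on (trans heights (height-on q∈C)))

      fork-parent : ∀ {p q} → p ∉ C → q ∉ C → gate p ≡ gate q → height p ≡ height q → 3 ≤ degree T p → q ≡ p
      fork-parent p∉C q∉C g h p₃ with fork p∉C p₃
      ... | pp∈C , _ , unique = unique q∉C
        (trans (start-parent q∉C (height≡1⇒start q∉C (trans (sym h) (height-start p∉C pp∈C))))
          (trans (sym g) (sym (start-parent p∉C pp∈C))))

      parents : parent x ≡ parent y
      parents with degree T (parent x) ℕ.≤? 2 | degree T (parent y) ℕ.≤? 2
      ... | no p≰2 | _ = sym (fork-parent p∉C q∉C gates heights (ℕ.≰⇒> p≰2))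
      ... | yes _ | no q≰2 = fork-parent q∉C p∉C (sym gates) (sym heights) (ℕ.≰⇒> q≰2)
      ... | yes p≤2 | yes q≤2 = hyp q∉C gates heights
            (trans (sym (side-inherit x∉C p∉C p≤2)) (trans s (side-inherit y∉C q∉C q≤2)))
            (≢m ∘ trans (side-inherit x∉C p∉C p≤2))

      same-parent : parent x ≡ parent y → x ≡ y
      same-parent px≡py with degree T (parent x) ℕ.≤? 2 | x ≟ y
      ... | _ | yes x≡y = x≡y
      ... | yes p≤2 | no x≢y = contradiction p≤2 (ℕ.<⇒≱ (≤degree {us = parent (parent x) ∷ x ∷ y ∷ []}
              ((grandparent≢ x∉C p∉C refl ∷ grandparent≢ y∉C p∉C (sym px≡py) ∷ []) ∷ (x≢y ∷ []) ∷ [] ∷ [])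
              (off-parent p∉C ∷ child-of x∉C refl ∷ child-of y∉C (sym px≡py) ∷ [])))
      ... | no p≰2 | no _ = rank-injective (x∉C , λ p∈C → contradiction p∈C p∉C)
              (y∉C , λ q∈C → contradiction q∈C q∉C) px≡py
              (trans (sym (side-fork x∉C p∉C (ℕ.≰⇒> p≰2)))
                (trans s (side-fork y∉C q∉C (subst (λ p → 3 ≤ degree T p) px≡py (ℕ.≰⇒> p≰2)))))

  private
    -- The spine vertex will have offset 0. Its leaves are at -1, the left side runs down from -2 at
    -- height 1, and the right side runs up from 1.
    offsetOf : Side → ℕ → ℤ
    offsetOf left   m = -[1+ m ]
    offsetOf middle _ = -[1+ 0 ]
    offsetOf right  m = + m

    Amid : ℤ → ℤ → ℤ → Set
    Amid i j k = (i ℤ.≤ j × j ℤ.≤ k) ⊎ (k ℤ.≤ j × j ℤ.≤ i)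

    amid-cong : ∀ {i j k i′ j′ k′} → i ≡ i′ → j ≡ j′ → k ≡ k′ → Amid i j k → Amid i′ j′ k′
    amid-cong refl refl refl a = a

    -- For the edge from a spine vertex to the start of a branch: only vertices attached to the same
    -- spine vertex fit under it.
    amid-start : ∀ σ τ k → Amid (+ 0) (offsetOf τ (suc k)) (offsetOf σ 1) → τ ≡ middle ⊎ suc k ≤ 1
    amid-start _      middle _ _                      = inj₁ refl
    amid-start left   left   _ (inj₂ (-≤- k≤ , _))    = inj₂ k≤
    amid-start right  right  _ (inj₁ (_ , +≤+ k≤))    = inj₂ k≤
    amid-start left   left   _ (inj₁ (() , _))
    amid-start middle left   _ (inj₁ (() , _))
    amid-start middle left   _ (inj₂ (-≤- () , _))
    amid-start right  left   _ (inj₁ (() , _))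
    amid-start right  left   _ (inj₂ (() , _))
    amid-start left   right  _ (inj₁ (_ , ()))
    amid-start middle right  _ (inj₁ (_ , ()))
    amid-start _      right  _ (inj₂ (_ , +≤+ ()))

    adjacent-heights : ∀ {m k} → m ≤ k → k ≤ suc m → k ≡ m ⊎ k ≡ suc m
    adjacent-heights m≤k k≤1+m with ℕ.m≤n⇒m<n∨m≡n m≤k
    ... | inj₁ m<k = inj₂ (ℕ.≤-antisym k≤1+m m<k)
    ... | inj₂ m≡k = inj₁ (sym m≡k)

    -- For an edge that stays on one side: its ends have consecutive heights.
    amid-branch : ∀ σ τ m k → σ ≢ middle → Amid (offsetOf σ (suc m)) (offsetOf τ k) (offsetOf σ (suc (suc m))) →
                  τ ≡ σ × (k ≡ suc m ⊎ k ≡ suc (suc m))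
    amid-branch middle _      _ _ ≢m _                           = contradiction refl ≢m
    amid-branch left   left   _ _ _  (inj₂ (-≤- k≤ , -≤- m≤))    = refl , adjacent-heights m≤ k≤
    amid-branch right  right  _ _ _  (inj₁ (+≤+ m≤ , +≤+ k≤))    = refl , adjacent-heights m≤ k≤
    amid-branch left   left   _ _ _  (inj₁ (-≤- k≤ , -≤- m≤))    = contradiction (ℕ.≤-trans m≤ k≤) ℕ.1+n≰n
    amid-branch right  right  _ _ _  (inj₂ (+≤+ m≤ , +≤+ k≤))    = contradiction (ℕ.≤-trans m≤ k≤) ℕ.1+n≰n
    amid-branch left   middle _ _ _  (inj₁ (_ , -≤- ()))
    amid-branch left   middle _ _ _  (inj₂ (_ , -≤- ()))
    amid-branch left   right  _ _ _  (inj₁ (_ , ()))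
    amid-branch left   right  _ _ _  (inj₂ (_ , ()))
    amid-branch right  left   _ _ _  (inj₁ (() , _))
    amid-branch right  left   _ _ _  (inj₂ (() , _))
    amid-branch right  middle _ _ _  (inj₁ (() , _))
    amid-branch right  middle _ _ _  (inj₂ (() , _))

    -- For the edge from a splitting vertex, at -2, to its right child, at 2.
    amid-fork : ∀ τ k → Amid (offsetOf left 1) (offsetOf τ k) (offsetOf right 2) →
                τ ≡ middle ⊎ k ≤ 1 ⊎ (τ ≡ right × k ≤ 2)
    amid-fork middle _ _                   = inj₁ refl
    amid-fork left   _ (inj₁ (-≤- k≤ , _)) = inj₂ (inj₁ k≤)
    amid-fork right  _ (inj₁ (_ , +≤+ k≤)) = inj₂ (inj₂ (refl , k≤))
    amid-fork left   _ (inj₂ (() , _))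
    amid-fork right  _ (inj₂ (_ , ()))

  offset : V → ℤ
  offset x with x ∈? C
  ... | yes _ = + 0
  ... | no _ = offsetOf (side x) (height x)

  offset-on : x ∈ C → offset x ≡ + 0
  offset-on {x} x∈C with x ∈? C
  ... | yes _ = refl
  ... | no x∉C = contradiction x∈C x∉C

  offset-off : x ∉ C → offset x ≡ offsetOf (side x) (height x)
  offset-off {x} x∉C with x ∈? C
  ... | yes x∈C = contradiction x∈C x∉C
  ... | no _ = refl

  -- Blocks follow the spine, offsets order each block, and the vertex itself breaks ties, which
  -- occur only among leaves at one spine vertex.
  key : V → ℕ × ℤ × V
  key x = depth (gate x) , offset x , x

  _≺_ : Rel V 0ℓ
  _≺_ = ×-Lex _≡_ _<_ (×-Lex _≡_ ℤ._<_ Fin._<_) on key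

  ≺-isStrictTotalOrder : IsStrictTotalOrder _≡_ _≺_
  ≺-isStrictTotalOrder = strictTotalOrder-on key (proj₂ ∘ proj₂)
    (×-isStrictTotalOrder ℕ.<-isStrictTotalOrder
      (×-isStrictTotalOrder ℤ.<-isStrictTotalOrder Fin.<-isStrictTotalOrder))

  open IsStrictTotalOrder ≺-isStrictTotalOrder using () renaming (irrefl to ≺-irrefl)

  ≺⇒block≤ : x ≺ y → depth (gate x) ≤ depth (gate y)
  ≺⇒block≤ (inj₁ lt) = ℕ.<⇒≤ lt
  ≺⇒block≤ (inj₂ (eq , _)) = ℕ.≤-reflexive eq

  ≺⇒offset≤ : x ≺ y → gate x ≡ gate y → offset x ℤ.≤ offset y
  ≺⇒offset≤ (inj₁ lt) eq = contradiction (cong depth eq) (ℕ.<⇒≢ lt)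
  ≺⇒offset≤ (inj₂ (_ , inj₁ lt)) _ = ℤ.<⇒≤ lt
  ≺⇒offset≤ (inj₂ (_ , inj₂ (eq , _))) _ = ℤ.≤-reflexive eq

  Between : V → V → V → Set
  Between p s x = (p ≺ s × s ≺ x) ⊎ (x ≺ s × s ≺ p)

  between-≢ : Between p s x → s ≢ p × s ≢ x
  between-≢ (inj₁ (a , b)) = (λ eq → ≺-irrefl (sym eq) a) , (λ eq → ≺-irrefl eq b)
  between-≢ (inj₂ (a , b)) = (λ eq → ≺-irrefl eq b) , (λ eq → ≺-irrefl (sym eq) a)

  between-gate : gate p ≡ gate x → Between p s x → gate s ≡ gate p
  between-gate {p} {x} {s} eq bt = depth-injective (gate∈ s) (gate∈ p) (squeeze bt)
    where
    squeeze : Between p s x → depth (gate s) ≡ depth (gate p)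
    squeeze (inj₁ (a , b)) = ℕ.≤-antisym (subst (λ g → depth (gate s) ≤ depth g) (sym eq) (≺⇒block≤ b)) (≺⇒block≤ a)
    squeeze (inj₂ (a , b)) = ℕ.≤-antisym (≺⇒block≤ b) (subst (λ g → depth g ≤ depth (gate s)) (sym eq) (≺⇒block≤ a))

  between-offset : gate p ≡ gate x → Between p s x → Amid (offset p) (offset s) (offset x)
  between-offset eq bt with between-gate eq bt | bt
  ... | g | inj₁ (a , b) = inj₁ (≺⇒offset≤ a (sym g) , ≺⇒offset≤ b (trans g eq))
  ... | g | inj₂ (a , b) = inj₂ (≺⇒offset≤ a (trans (sym eq) (sym g)) , ≺⇒offset≤ b g)

  -- Depth is injective and nondecreasing in the order along the spine, and the ends of the edge
  -- have consecutive depths.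
  spine-edge : x ∈ C → Child x p → Between p s x → s ∉ C
  spine-edge {x} {p} {s} x∈C ch bt s∈C with between-≢ bt
  ... | s≢p , s≢x = [ s≢p ∘ depth-injective s∈C p∈C , s≢x ∘ depth-injective s∈C x∈C ∘ (λ eq → trans eq (sym (proj₂ ch))) ]′
                      (depths bt)
    where
    p∈C = child∈ ch x∈C
    block : ∀ {u v} → u ∈ C → v ∈ C → u ≺ v → depth u ≤ depth v
    block {u} {v} u∈C v∈C lt = subst₂ (λ a b → depth a ≤ depth b) (gate-on u∈C) (gate-on v∈C) (≺⇒block≤ lt)
    depths : Between p s x → depth s ≡ depth p ⊎ depth s ≡ suc (depth p)
    depths (inj₁ (a , b)) = adjacent-heights (block p∈C s∈C a)
      (ℕ.≤-trans (block s∈C x∈C b) (ℕ.≤-reflexive (proj₂ ch)))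
    depths (inj₂ (a , b)) = contradiction
      (ℕ.≤-trans (ℕ.≤-reflexive (sym (proj₂ ch))) (ℕ.≤-trans (block x∈C s∈C a) (block s∈C p∈C b))) ℕ.1+n≰n

  -- Blocks are intervals, so `s` has the same gate; its offset makes it a leaf or the start of a
  -- branch there, hence a neighbour of the gate.
  attaching-edge : x ∉ C → parent x ∈ C → Between (parent x) s x → s ∉ C × Adj (parent x) s
  attaching-edge {x} {s} x∉C p∈C bt = s∉C , child-of s∉C (trans (start-parent s∉C q∈C) g)
    where
    g : gate s ≡ parent x
    g = trans (between-gate (sym (gate-parent x∉C)) bt) (gate-on p∈C)

    s∉C : s ∉ C
    s∉C s∈C = proj₁ (between-≢ bt) (trans (sym (gate-on s∈C)) g)

    amid : Amid (+ 0) (offsetOf (side s) (suc (height (parent s)))) (offsetOf (side x) 1)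
    amid = amid-cong (offset-on p∈C) (trans (offset-off s∉C) (cong (offsetOf (side s)) (height-off s∉C)))
      (trans (offset-off x∉C) (cong (offsetOf (side x)) (height-start x∉C p∈C)))
      (between-offset (sym (gate-parent x∉C)) bt)

    q∈C : parent s ∈ C
    q∈C with amid-start (side x) (side s) (height (parent s)) amid
    ... | inj₁ mid = proj₁ (middle⇒leaf s∉C mid)
    ... | inj₂ (s≤s h≤0) = height≡0⇒on (ℕ.n≤0⇒n≡0 h≤0)

  -- An intervening vertex would share its position with an end of the edge, except where a branch
  -- turns from left to right; there the splitting vertex is alone at its gate, which empties the
  -- gap.
  branch-edge : x ∉ C → parent x ∉ C → Between (parent x) s x → s ∉ C → ⊥
  branch-edge {x} {s} x∉C p∉C bt s∉C = impossible (degree T w ℕ.≤? 2)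
    where
    w = parent x
    s≢p = proj₁ (between-≢ bt)
    s≢x = proj₂ (between-≢ bt)

    g-s : gate s ≡ gate w
    g-s = between-gate (sym (gate-parent x∉C)) bt

    h-x : height x ≡ suc (suc (height (parent w)))
    h-x = trans (height-off x∉C) (cong suc (height-off p∉C))

    amid : ∀ {σ τ} → side w ≡ σ → side x ≡ τ →
           Amid (offsetOf σ (suc (height (parent w)))) (offsetOf (side s) (height s)) (offsetOf τ (suc (suc (height (parent w)))))
    amid refl refl = amid-cong (trans (offset-off p∉C) (cong (offsetOf (side w)) (height-off p∉C))) (offset-off s∉C)
      (trans (offset-off x∉C) (cong (offsetOf (side x)) h-x)) (between-offset (sym (gate-parent x∉C)) bt)

    side-x≢middle : side x ≢ middle
    side-x≢middle mid = p∉C (proj₁ (middle⇒leaf x∉C mid))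

    side-p≢middle : side w ≢ middle
    side-p≢middle mid = contradiction (proj₂ (middle⇒leaf p∉C mid)) (ℕ.<⇒≱ (parent∉⇒2≤ x∉C p∉C))

    straight : side x ≡ side w → ⊥
    straight eq with amid-branch (side w) (side s) (height (parent w)) (height s) side-p≢middle (amid refl eq)
    ... | σ , inj₁ h = s≢p (position-injective s∉C p∉C g-s (trans h (sym (height-off p∉C))) σ
                         (side-p≢middle ∘ trans (sym σ)))
    ... | σ , inj₂ h = s≢x (position-injective s∉C x∉C (trans g-s (sym (gate-parent x∉C))) (trans h (sym h-x))
                         (trans σ (sym eq)) (side-p≢middle ∘ trans (sym σ)))

    turning : 3 ≤ degree T w → ∀ τ → side x ≡ τ → ⊥
    turning p₃ τ eq with fork p∉C p₃
    ... | pp∈C , _ , unique = turn τ eq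
      where
      side-p : side w ≡ left
      side-p = trans (side-start p∉C pp∈C (ℕ.<⇒≤ p₃)) (sole-branch-left λ (y∉C , _) q → unique y∉C q)

      not-start : parent s ∉ C
      not-start q∈C = s≢p (unique s∉C (trans (start-parent s∉C q∈C) (trans g-s (sym (start-parent p∉C pp∈C)))))

      -- Height 1 belongs to the splitting vertex alone; the only position left for `s` is that of
      -- `x`.
      high : 2 ≤ height s
      high = ℕ.≤∧≢⇒< (ℕ.≤-trans (s≤s z≤n) (ℕ.≤-reflexive (sym (height-off s∉C)))) (not-start ∘ height≡1⇒start s∉C ∘ sym)

      h-pp : height (parent w) ≡ 0
      h-pp = height-on pp∈C

      turn : ∀ τ → side x ≡ τ → ⊥
      turn left eq = straight (trans eq (sym side-p))
      turn middle eq = side-x≢middle eq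
      turn right eq with amid-fork (side s) (height s)
        (subst (λ h → Amid (offsetOf left (suc h)) (offsetOf (side s) (height s)) (offsetOf right (suc (suc h)))) h-pp (amid side-p eq))
      ... | inj₁ mid = not-start (proj₁ (middle⇒leaf s∉C mid))
      ... | inj₂ (inj₁ h≤1) = contradiction high (ℕ.<⇒≱ (s≤s h≤1))
      ... | inj₂ (inj₂ (σ , h≤2)) = s≢x (position-injective s∉C x∉C (trans g-s (sym (gate-parent x∉C)))
              (trans (ℕ.≤-antisym h≤2 high) (sym (trans h-x (cong (λ h → suc (suc h)) h-pp))))
              (trans σ (sym eq)) (side-x≢middle ∘ trans (trans eq (sym σ))))

    impossible : Dec (degree T w ≤ 2) → ⊥
    impossible (yes p≤2) = straight (side-inherit x∉C p∉C p≤2)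
    impossible (no p≰2) = turning (ℕ.≰⇒> p≰2) (side x) refl

  class : V → Fin 2
  class x with x ∈? C
  ... | yes _ = zero
  ... | no _ = suc zero

  class-on : x ∈ C → class x ≡ zero
  class-on {x} x∈C with x ∈? C
  ... | yes _ = refl
  ... | no x∉C = contradiction x∈C x∉C

  class-off : x ∉ C → class x ≡ suc zero
  class-off {x} x∉C with x ∈? C
  ... | yes x∈C = contradiction x∈C x∉C
  ... | no _ = refl

  class≢ : ∀ {u v} → u ∈ C → v ∉ C → class u ≢ class v
  class≢ u∈C v∉C eq with () ← trans (sym (class-on u∈C)) (trans eq (class-off v∉C))

  -- `Between` covers both orders of the ends, so one case analysis by child and parent serves for
  -- all edges.
  separated : Child x p → Between p s x → (class p ≡ class s → Adj s x) × (class s ≡ class x → Adj p s)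
  separated {x} {s = s} ch@(refl , _) bt = split (x ∈? C) (parent x ∈? C) (s ∈? C)
    where
    split : Dec (x ∈ C) → Dec (parent x ∈ C) → Dec (s ∈ C) →
            (class (parent x) ≡ class s → Adj s x) × (class s ≡ class x → Adj (parent x) s)
    split (yes x∈C) _ _ =
      (λ eq → contradiction eq (class≢ (child∈ ch x∈C) (spine-edge x∈C ch bt))) ,
      (λ eq → contradiction (sym eq) (class≢ x∈C (spine-edge x∈C ch bt)))
    split (no x∉C) (yes p∈C) _ with attaching-edge x∉C p∈C bt
    ... | s∉C , a = (λ eq → contradiction eq (class≢ p∈C s∉C)) , (λ _ → a)
    split (no x∉C) (no p∉C) (yes s∈C) =
      (λ eq → contradiction (sym eq) (class≢ s∈C p∉C)) , (λ eq → contradiction eq (class≢ s∈C x∉C))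
    split (no x∉C) (no p∉C) (no s∉C) = ⊥-elim (branch-edge x∉C p∉C bt s∉C)

  consistent : StronglyConsistent T _≺_ class
  consistent p q a with adj⇒child a
  ... | inj₂ ch = separated ch (inj₁ (p , q))
  ... | inj₁ ch with separated ch (inj₂ (p , q))
  ...   | f , g = (λ eq → adj-sym (g (sym eq))) , (λ eq → adj-sym (f (sym eq)))

  properThin : ∀ {v} → v ∉ C → ProperThin T 2
  properThin v∉C = _≺_ , class , ≺-isStrictTotalOrder ,
    (λ { zero → ρ , class-on root∈ ; (suc zero) → _ , class-off v∉C }) , consistent

-- The hypotheses of the layout from conditions (1) to (3).

module SpineToOrder {n : ℕ} (T : Graph n) (isTree : IsTree T)
                    (few : FewNonLeafNeighbors T) (hasSpine : HasSpine T) where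
  open Graph T renaming (sym to adj-sym)
  open Trees T isTree
  open Spines T isTree

  private
    C = proj₁ (maximal-spine hasSpine)

    maximal : Maximal C
    maximal = proj₂ (maximal-spine hasSpine)

    spine : Path _ _ C
    spine = proj₂ (proj₂ (proj₁ (proj₁ maximal)))

    open Spine T isTree spine

    variable
      x y z u : Fin n

    ≢-∉ : x ∈ C → y ∉ C → x ≢ y
    ≢-∉ x∈C y∉C refl = y∉C x∈C

  -- The attachment `w` has a non-leaf off the spine, so its role is `interior`. Two spine
  -- neighbours, `z` and a further child would give it degree 4, against (3b).
  fork : SplitsAtSpine
  fork {z} z∉C z₃ = subst (_∈ C) (sym pz≡w) w∈C , z≤3 , λ y∉C eq → sole y∉C (trans eq pz≡w)
    where
    z≤3 : degree T z ≤ 3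
    z≤3 = ℕ.≤-pred (ℕ.≰⇒> λ z₄ → z∉C (proj₁ (proj₂ (proj₁ maximal)) z z₄))

    attachment = proj₂ (proj₂ (proj₁ maximal)) z (ℕ.≤-antisym z≤3 z₃) z∉C
    w = proj₁ attachment
    w∈C = proj₁ (proj₂ attachment)
    zw = proj₁ (proj₂ (proj₂ attachment))
    w≤3 = proj₂ (proj₂ (proj₂ attachment))

    pz≡w : parent z ≡ w
    pz≡w = attached-parent zw z∉C w∈C

    sole : y ∉ C → parent y ≡ w → y ≡ z
    sole {y} y∉C py≡w with y ≟ z | role maximal w∈C
    ... | yes y≡z | _ = y≡z
    ... | no _ | closed f = contradiction (f (adj-sym zw)) z∉C
    ... | no _ | leafy f = contradiction (f (adj-sym zw) z∉C) (ℕ.<⇒≱ (ℕ.<⇒≤ z₃))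
    ... | no y≢z | interior {c′} {c″} c′∈C c″∈C c′≢c″ a′ a″ _ _ =
      contradiction w≤3 (ℕ.<⇒≱ (≤degree {us = c′ ∷ c″ ∷ y ∷ z ∷ []}
        ( (c′≢c″ ∷ ≢-∉ c′∈C y∉C ∷ ≢-∉ c′∈C z∉C ∷ []) ∷ (≢-∉ c″∈C y∉C ∷ ≢-∉ c″∈C z∉C ∷ [])
        ∷ (y≢z ∷ []) ∷ [] ∷ [])
        (a′ ∷ a″ ∷ child-of y∉C py≡w ∷ adj-sym zw ∷ [])))

  -- Three branches and two non-leaf spine neighbours would be five non-leaf neighbours, against
  -- (2).
  two-branches : AtMostTwoBranches
  two-branches {x} {y} {z} x∉C y∉C z∉C p∈C x₂ y₂ z₂ px≡py px≡pz x≢y x≢z y≢z with role maximal p∈C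
  ... | closed f = x∉C (f (child-of x∉C refl))
  ... | leafy f = contradiction (f (child-of x∉C refl) x∉C) (ℕ.<⇒≱ x₂)
  ... | interior {c′} {c″} c′∈C c″∈C c′≢c″ a′ a″ c′₂ c″₂ = contradiction (few _ five) (ℕ.<⇒≱ fiveNonLeaves)
    where
    distinct : Unique (c′ ∷ c″ ∷ x ∷ y ∷ z ∷ [])
    distinct = (c′≢c″ ∷ ≢-∉ c′∈C x∉C ∷ ≢-∉ c′∈C y∉C ∷ ≢-∉ c′∈C z∉C ∷ [])
             ∷ (≢-∉ c″∈C x∉C ∷ ≢-∉ c″∈C y∉C ∷ ≢-∉ c″∈C z∉C ∷ [])
             ∷ (x≢y ∷ x≢z ∷ []) ∷ (y≢z ∷ []) ∷ [] ∷ []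

    nonLeaves : All (λ u → Adj (parent x) u × 2 ≤ degree T u) (c′ ∷ c″ ∷ x ∷ y ∷ z ∷ [])
    nonLeaves = (a′ , c′₂) ∷ (a″ , c″₂) ∷ (child-of x∉C refl , x₂) ∷
                (child-of y∉C (sym px≡py) , y₂) ∷ (child-of z∉C (sym px≡pz) , z₂) ∷ []

    five : 5 ≤ degree T (parent x)
    five = ≤degree distinct (All.map proj₁ nonLeaves)

    fiveNonLeaves : 5 ≤ length (nonLeafNeighbors T (parent x))
    fiveNonLeaves = ≤nonLeafNeighbors distinct nonLeaves

  -- Makes the second class nonempty. If the spine were the whole tree, each vertex would have at
  -- most its parent and one child as neighbours.
  off-spine-vertex : HasVertexOfDegree≥3 T → ∃[ v ] v ∉ C
  off-spine-vertex (v , v₃) with any? (λ u → ¬? (u ∈? C))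
  ... | yes found = found
  ... | no none = contradiction v₃ (ℕ.<⇒≱ (s≤s (degree≤ {Qs = (_≡ parent v) ∷ (λ u → Child u v) ∷ []}
          ((λ { refl refl → refl }) ∷ (λ (_ , d) (_ , d′) → depth-injective (on _) (on _) (trans d (sym d′))) ∷ []) cover)))
    where
    on : ∀ u → u ∈ C
    on u = decidable-stable (u ∈? C) λ u∉C → none (u , u∉C)
    cover : Adj v u → Any (λ Q → Q u) ((_≡ parent v) ∷ (λ u → Child u v) ∷ [])
    cover a with adj⇒child a
    ... | inj₁ (eq , _) = here (sym eq)
    ... | inj₂ ch = there (here ch)

  properThin : HasVertexOfDegree≥3 T → ProperThin T 2
  properThin v₃ = Layout.properThin T isTree spine fork two-branches (proj₂ (off-spine-vertex v₃))

-- Lower bound on the number of classes, and assembly.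

module _ {n : ℕ} (T : Graph n) (isTree : IsTree T) where
  open Graph T renaming (sym to adj-sym)
  open Trees T isTree

  -- With a single class the triangle argument applies to every vertex under an edge, leaving one
  -- neighbour on each side.
  properThin-1⇒degree≤2 : ProperThin T 1 → ∀ v → degree T v ≤ 2
  properThin-1⇒degree≤2 (_≺_ , class , sto , _ , consistent) v =
    degree≤ {Qs = (λ u → Adj v u × u ≺ v) ∷ (λ u → Adj v u × v ≺ u) ∷ []} (before ∷ after ∷ []) cover
    where
    open IsStrictTotalOrder sto using (compare)

    one-class : ∀ x y → class x ≡ class y
    one-class x y with class x | class y
    ... | zero | zero = refl

    tight : ∀ {r s t} → r ≺ s → s ≺ t → Adj r t → ⊥
    tight p q a with consistent p q a
    ... | f , g = no-triangle (g (one-class _ _)) (f (one-class _ _)) a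

    before : AtMostOne (λ u → Adj v u × u ≺ v)
    before {x} {y} (a , p) (b , q) with compare x y
    ... | tri< x≺y _ _ = ⊥-elim (tight x≺y q (adj-sym a))
    ... | tri≈ _ x≡y _ = x≡y
    ... | tri> _ _ y≺x = ⊥-elim (tight y≺x p (adj-sym b))

    after : AtMostOne (λ u → Adj v u × v ≺ u)
    after {x} {y} (a , p) (b , q) with compare x y
    ... | tri< x≺y _ _ = ⊥-elim (tight p x≺y b)
    ... | tri≈ _ x≡y _ = x≡y
    ... | tri> _ _ y≺x = ⊥-elim (tight q y≺x a)

    cover : ∀ {u} → Adj v u → Any (λ Q → Q u) ((λ u → Adj v u × u ≺ v) ∷ (λ u → Adj v u × v ≺ u) ∷ [])
    cover {u} a with compare u v
    ... | tri< u≺v _ _ = here (a , u≺v)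
    ... | tri≈ _ u≡v _ = contradiction (sym u≡v) (adj⇒≢ a)
    ... | tri> _ _ v≺u = there (here (a , v≺u))

  2≤classes : HasVertexOfDegree≥3 T → ∀ j → ProperThin T j → 2 ≤ j
  2≤classes (v , _) zero (_ , class , _) with () ← class v
  2≤classes (v , v₃) (suc zero) thin = contradiction v₃ (ℕ.<⇒≱ (s≤s (properThin-1⇒degree≤2 thin v)))
  2≤classes _ (suc (suc _)) _ = s≤s (s≤s z≤n)

  -- Otherwise the depth order of a tree of maximum degree 2 would do with one class.
  hasVertexOfDegree≥3 : (∀ j → ProperThin T j → 2 ≤ j) → HasVertexOfDegree≥3 T
  hasVertexOfDegree≥3 minimal with any? (λ v → 3 ℕ.≤? degree T v)
  ... | yes found = found
  ... | no none = contradiction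
          (minimal 1 (LinearTree.properThin T isTree λ v → ℕ.≤-pred (ℕ.≰⇒> λ v₃ → none (v , v₃)))) ℕ.1+n≰n

  properThin-2⇒spine : ProperThin T 2 → FewNonLeafNeighbors T × HasSpine T
  properThin-2⇒spine (_≺_ , class , sto , _ , consistent)
    with least sto (IsTree.nonempty isTree) | least (Flip.isStrictTotalOrder sto) (IsTree.nonempty isTree)
  ... | ρ , ρ-least | ζ , ζ-greatest =
    (λ v _ → NonLeaves.fewNonLeafNeighbors T isTree sto {class} consistent v) ,
    Extremes.hasSpine T isTree sto {class} consistent ρ-least ζ-greatest (proj₂ (path-between ρ ζ))

theorem1 : ∀ {n : ℕ} (T : Graph n) → IsTree T →
    HasProperThinness T 2 ⇔ (HasVertexOfDegree≥3 T × FewNonLeafNeighbors T × HasSpine T)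
theorem1 T isTree = mk⇔
  (λ (thin , minimal) → hasVertexOfDegree≥3 T isTree minimal , properThin-2⇒spine T isTree thin)
  (λ (v₃ , few , spine) → SpineToOrder.properThin T isTree few spine v₃ , 2≤classes T isTree v₃)
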